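{- Let $n \geq 4$ and let $H$ be a graph with a unique vertex $v$ of maximum degree, this maximum degree being $n+1$, such that $H - v$ has maximum degree at most $n-1$. Let $H'$ be the graph obtained from $H$ by an $(n+1)$-subdivision. Then there is $k \in \mathbb{N}$ such that $\square^n K_k$ is $H'$-induced-saturated.
   Context: All graphs are finite and simple; $\mathbb{N}=\{1,2,\dots\}$. For graphs $H,G$, write $H \subseteq_I G$ if $G$ contains an induced subgraph isomorphic to $H$. A graph $G$ on at least two vertices is $H$-induced-saturated if $H \not\subseteq_I G$, but $H \subseteq_I G - e$ for every edge $e \in E(G)$ and $H \subseteq_I G + e$ for every edge $e \in E(\overline{G})$ of the complement. $\square^n K_k$ is the Cartesian product of $n$ cliques of order $k$: its vertices are all $n$-tuples with entries in a fixed $k$-element set, two tuples being adjacent iff they differ in exactly one coordinate. A graph $H'$ is obtained from $H$ by a $k$-subdivision if $V(H')$ is the disjoint union of $V(H)$ and sets $V_e$, $e \in E(H)$, where for each $xy \in E(H)$ we have $|V_{xy}| = k$ and $V_{xy}\cup\{x,y\}$ induces a path with endpoints $x$ and $y$, and there are no other edges in $H'$ (i.e. each edge of $H$ is subdivided with $k$ new vertices). -}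

module Defs where

open import Data.Fin.Base as Fin using (Fin; zero; suc; inject₁)
import Data.Fin.Properties as Fin
open import Data.Fin.Relation.Unary.Top using (view; view-inject₁; ‵fromℕ; ‵inject₁)
open import Data.Irrelevant using ([_])
open import Data.List.Base as List
  using (List; []; _∷_; length; filter; allFin; cartesianProduct; cartesianProductWith)
open import Data.List.Extrema.Nat using (max)
open import Data.List.Membership.Propositional using (_∈_; find; lose)
open import Data.List.Membership.Propositional.Properties
  using (∈-map⁺; ∈-map⁻; ∈-++⁺ˡ; ∈-++⁺ʳ; ∈-allFin; ∈-cartesianProduct⁺; ∈-cartesianProductWith⁺)
open import Data.List.Membership.Setoid.Properties using (index-injective)
open import Data.List.Relation.Unary.All as All using (All)
open import Data.List.Relation.Unary.Any as Any using (here; there; index)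
open import Data.List.Relation.Unary.AllPairs using ([]; _∷_)
open import Data.List.Relation.Unary.Unique.Propositional using (Unique)
import Data.List.Relation.Unary.Unique.Propositional.Properties as Unique
open import Data.Nat.Base using (ℕ; zero; suc; _≤_)
import Data.Nat.Properties as ℕ
open import Data.Product.Base using (_×_; _,_; Σ-syntax; ∃; ∃-syntax; proj₁; proj₂)
open import Data.Product using (∃!)
open import Data.Refinement using (Refinement; value) renaming (_,_ to _‖_)
open import Data.Sum.Base as Sum using (_⊎_; inj₁; inj₂)
open import Data.Sum.Properties using (inj₁-injective; inj₂-injective)
import Data.Vec.Properties as Vec
open import Data.Vec.Base as Vec using (Vec; lookup)
open import Function.Base using (_∘_)
open import Function.Bundles using (_↔_; _⇔_; Inverse)
open import Level using (0ℓ)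
open import Relation.Binary.Core using (Rel)
open import Relation.Binary.Definitions
  using (Symmetric; Irreflexive; DecidableEquality) renaming (Decidable to Decidable₂)
open import Relation.Binary.PropositionalEquality
  using (_≡_; _≢_; refl; sym; trans; cong; setoid)
open import Relation.Nullary using (¬_; Dec; yes; no; ¬?; _×-dec_; _⊎-dec_; _→-dec_; contradiction)
open import Relation.Nullary.Decidable using (map′; recompute)
open import Relation.Unary using (Pred; Decidable)

record Finite (A : Set) : Set where
  field
    elements : List A
    complete : ∀ x → x ∈ elements
    unique   : Unique elements

  size : ℕ
  size = length elements

  rank : A → Fin size
  rank x = index (complete x)

  rank-injective : ∀ {x y} → rank x ≡ rank y → x ≡ y
  rank-injective {x} {y} = index-injective (setoid A) (complete x) (complete y)

  _≟_ : DecidableEquality A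
  x ≟ y = map′ rank-injective (cong rank) (rank x Fin.≟ rank y)

  any? : ∀ {P : Pred A 0ℓ} → Decidable P → Dec (∃ P)
  any? P? = map′ (λ p → let x , _ , px = find p in x , px)
                 (λ (x , px) → lose (complete x) px)
                 (Any.any? P? elements)

fin-finite : ∀ n → Finite (Fin n)
fin-finite n = record
  { elements = allFin n
  ; complete = ∈-allFin
  ; unique   = Unique.allFin⁺ n
  }

module _ {A B : Set} (FA : Finite A) (FB : Finite B) where
  private
    module A = Finite FA
    module B = Finite FB

  ×-finite : Finite (A × B)
  ×-finite = record
    { elements = cartesianProduct A.elements B.elements
    ; complete = λ (x , y) → ∈-cartesianProduct⁺ (A.complete x) (B.complete y)
    ; unique   = Unique.cartesianProduct⁺ A.unique B.unique
    }

  ⊎-finite : Finite (A ⊎ B)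
  ⊎-finite = record
    { elements = List.map inj₁ A.elements List.++ List.map inj₂ B.elements
    ; complete = Sum.[ (λ x → ∈-++⁺ˡ (∈-map⁺ inj₁ (A.complete x)))
                     , (λ y → ∈-++⁺ʳ _ (∈-map⁺ inj₂ (B.complete y))) ]
    ; unique   = Unique.++⁺ (Unique.map⁺ inj₁-injective A.unique)
                            (Unique.map⁺ inj₂-injective B.unique)
                            disjoint
    }
    where
    disjoint : ∀ {z} → ¬ (z ∈ List.map inj₁ A.elements × z ∈ List.map inj₂ B.elements)
    disjoint (p , q) with ∈-map⁻ inj₁ p | ∈-map⁻ inj₂ q
    ... | _ , _ , refl | _ , _ , ()

vec-finite : ∀ {A : Set} → Finite A → ∀ n → Finite (Vec A n)
vec-finite FA zero = record
  { elements = Vec.[] ∷ []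
  ; complete = λ { Vec.[] → here refl }
  ; unique   = All.[] ∷ []
  }
vec-finite FA (suc n) = record
  { elements = cartesianProductWith Vec._∷_ A.elements As.elements
  ; complete = λ { (x Vec.∷ xs) → ∈-cartesianProductWith⁺ Vec._∷_ (A.complete x) (As.complete xs) }
  ; unique   = Unique.cartesianProductWith⁺ Vec._∷_ Vec.∷-injective A.unique As.unique
  }
  where
  module A = Finite FA
  module As = Finite (vec-finite FA n)

module _ {A : Set} {P : Pred A 0ℓ} (P? : Decidable P) where
  private
    restrict : List A → List (Refinement A P)
    restrict []       = []
    restrict (x ∷ xs) with P? x
    ... | yes px = (x ‖ [ px ]) ∷ restrict xs
    ... | no  _  = restrict xs

    restrict-∈ : ∀ {x xs} .(px : P x) → x ∈ xs → (x ‖ [ px ]) ∈ restrict xs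
    restrict-∈ {x} px (here refl) with P? x
    ... | yes _  = here refl
    ... | no ¬px = contradiction (recompute (P? x) px) ¬px
    restrict-∈ {xs = y ∷ _} px (there x∈xs) with P? y
    ... | yes _ = there (restrict-∈ px x∈xs)
    ... | no  _ = restrict-∈ px x∈xs

    restrict-All : ∀ {x xs} .(px : P x) → All (x ≢_) xs → All ((x ‖ [ px ]) ≢_) (restrict xs)
    restrict-All px All.[] = All.[]
    restrict-All {xs = y ∷ _} px (x≢y All.∷ x≢ys) with P? y
    ... | yes _ = (x≢y ∘ cong value) All.∷ restrict-All px x≢ys
    ... | no  _ = restrict-All px x≢ys

    restrict-Unique : ∀ {xs} → Unique xs → Unique (restrict xs)
    restrict-Unique [] = []
    restrict-Unique {x ∷ _} (x≢xs ∷ xs!) with P? x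
    ... | yes px = restrict-All px x≢xs ∷ restrict-Unique xs!
    ... | no  _  = restrict-Unique xs!

  refinement-finite : Finite A → Finite (Refinement A P)
  refinement-finite FA = record
    { elements = restrict A.elements
    ; complete = λ { (x ‖ [ px ]) → restrict-∈ px (A.complete x) }
    ; unique   = restrict-Unique A.unique
    }
    where module A = Finite FA

record Graph : Set₁ where
  infix 4 _~_ _~?_
  field
    Vertex   : Set
    finite   : Finite Vertex
    _~_      : Rel Vertex 0ℓ
    ~-sym    : Symmetric _~_
    ~-irrefl : Irreflexive _≡_ _~_
    _~?_     : Decidable₂ _~_

  open Finite finite public

  order : ℕ
  order = size

  degree : Vertex → ℕ
  degree v = length (filter (v ~?_) elements)

  -- For the graph without vertices this is 0.
  maxDegree : ℕ
  maxDegree = max 0 (List.map degree elements)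

open Graph using (Vertex)

infix 4 _≅_ _⊆ᴵ_

record _≅_ (G H : Graph) : Set where
  private
    module G = Graph G
    module H = Graph H
  field
    bijection : G.Vertex ↔ H.Vertex
  open Inverse bijection public using (to; from)
  field
    adjacent⇔ : ∀ x y → (x G.~ y) ⇔ (to x H.~ to y)

induced : (G : Graph) {S : Pred (Vertex G) 0ℓ} → Decidable S → Graph
induced G {S} S? = record
  { Vertex   = Refinement G.Vertex S
  ; finite   = refinement-finite S? G.finite
  ; _~_      = λ x y → value x G.~ value y
  ; ~-sym    = G.~-sym
  ; ~-irrefl = λ { refl → G.~-irrefl refl }
  ; _~?_     = λ x y → value x G.~? value y
  }
  where module G = Graph G

_⊆ᴵ_ : Graph → Graph → Set₁
H ⊆ᴵ G = Σ[ S ∈ Pred (Vertex G) 0ℓ ] Σ[ S? ∈ Decidable S ] H ≅ induced G S?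

infixl 6 _-ᵛ_

_-ᵛ_ : (G : Graph) → Vertex G → Graph
G -ᵛ v = induced G (λ u → ¬? (u G.≟ v))
  where module G = Graph G

complement : Graph → Graph
complement G = record
  { Vertex   = G.Vertex
  ; finite   = G.finite
  ; _~_      = λ x y → x ≢ y × ¬ x G.~ y
  ; ~-sym    = λ (x≢y , x≁y) → x≢y ∘ sym , x≁y ∘ G.~-sym
  ; ~-irrefl = λ x≡y (x≢y , _) → x≢y x≡y
  ; _~?_     = λ x y → ¬? (x G.≟ y) ×-dec ¬? (x G.~? y)
  }
  where module G = Graph G

-- Equality of the unordered pairs {u , v} and {x , y}.
SamePair : ∀ {A : Set} → A → A → A → A → Set
SamePair u v x y = (u ≡ x × v ≡ y) ⊎ (u ≡ y × v ≡ x)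

samePair-swap : ∀ {A : Set} {u v x y : A} → SamePair u v x y → SamePair v u x y
samePair-swap (inj₁ (p , q)) = inj₂ (q , p)
samePair-swap (inj₂ (p , q)) = inj₁ (q , p)

samePair? : ∀ {A : Set} → DecidableEquality A → (u v x y : A) → Dec (SamePair u v x y)
samePair? _≟_ u v x y = (u ≟ x ×-dec v ≟ y) ⊎-dec (u ≟ y ×-dec v ≟ x)

deleteEdge : (G : Graph) (x y : Vertex G) → Graph._~_ G x y → Graph
deleteEdge G x y _ = record
  { Vertex   = G.Vertex
  ; finite   = G.finite
  ; _~_      = λ u v → u G.~ v × ¬ SamePair u v x y
  ; ~-sym    = λ (u~v , ne) → G.~-sym u~v , ne ∘ samePair-swap
  ; ~-irrefl = λ u≡v (u~v , _) → G.~-irrefl u≡v u~v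
  ; _~?_     = λ u v → (u G.~? v) ×-dec ¬? (samePair? G._≟_ u v x y)
  }
  where module G = Graph G

addEdge : (G : Graph) (x y : Vertex G) → Graph._~_ (complement G) x y → Graph
addEdge G x y (x≢y , _) = record
  { Vertex   = G.Vertex
  ; finite   = G.finite
  ; _~_      = λ u v → u G.~ v ⊎ SamePair u v x y
  ; ~-sym    = Sum.map G.~-sym samePair-swap
  ; ~-irrefl = λ { refl → Sum.[ G.~-irrefl refl
                              , Sum.[ (λ (p , q) → x≢y (trans (sym p) q))
                                    , (λ (p , q) → x≢y (trans (sym q) p)) ] ] }
  ; _~?_     = λ u v → (u G.~? v) ⊎-dec samePair? G._≟_ u v x y
  }
  where module G = Graph G

record InducedSaturated (H G : Graph) : Set₁ where
  private
    module G = Graph G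
    module Gᶜ = Graph (complement G)
  field
    nontrivial : 2 ≤ G.order
    free       : ¬ H ⊆ᴵ G
    saturated⁻ : ∀ {x y} (e : x G.~ y) → H ⊆ᴵ deleteEdge G x y e
    saturated⁺ : ∀ {x y} (e : x Gᶜ.~ y) → H ⊆ᴵ addEdge G x y e

□^_K_ : ℕ → ℕ → Graph
□^ n K k = record
  { Vertex   = Vec (Fin k) n
  ; finite   = vec-finite (fin-finite k) n
  ; _~_      = _~_
  ; ~-sym    = λ (i , p , unq) → i , p ∘ sym , λ q → unq (q ∘ sym)
  ; ~-irrefl = λ { refl (_ , p , _) → p refl }
  ; _~?_     = λ x y → Fin.any? λ i →
      differ? x y i ×-dec
      map′ (λ h {j} → h j) (λ h j → h {j})
           (Fin.all? λ j → differ? x y j →-dec (i Fin.≟ j))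
  }
  where
  _~_ : Rel (Vec (Fin k) n) 0ℓ
  x ~ y = ∃! _≡_ λ i → lookup x i ≢ lookup y i

  differ? : ∀ x y i → Dec (lookup x i ≢ lookup y i)
  differ? x y i = ¬? (lookup x i Fin.≟ lookup y i)

module Subdivision (k : ℕ) (H : Graph) where
  private module H = Graph H

  -- Each edge xy is represented by exactly one of (x , y) and (y , x),
  -- namely the one that is increasing in the enumeration of the vertices.
  IncreasingEdge : Pred (H.Vertex × H.Vertex) 0ℓ
  IncreasingEdge (x , y) = H.rank x Fin.< H.rank y × x H.~ y

  increasingEdge? : Decidable IncreasingEdge
  increasingEdge? (x , y) = (H.rank x Fin.<? H.rank y) ×-dec (x H.~? y)

  Edge : Set
  Edge = Refinement (H.Vertex × H.Vertex) IncreasingEdge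

  edge-finite : Finite Edge
  edge-finite = refinement-finite increasingEdge? (×-finite H.finite H.finite)

  source target : Edge → H.Vertex
  source e = proj₁ (value e)
  target e = proj₂ (value e)

  source≢target : ∀ e → source e ≢ target e
  source≢target ((x , y) ‖ [ p ]) refl =
    H.~-irrefl refl (proj₂ (recompute (increasingEdge? (x , y)) p))

  V′ : Set
  V′ = H.Vertex ⊎ (Edge × Fin k)

  V′-finite : Finite V′
  V′-finite = ⊎-finite H.finite (×-finite edge-finite (fin-finite k))

  -- The vertices, in order, of the path replacing e: its source, the k new
  -- vertices, its target.
  path : Edge → Fin (suc (suc k)) → V′
  path e zero    = inj₁ (source e)
  path e (suc i) with view i
  ... | ‵fromℕ     = inj₁ (target e)
  ... | ‵inject₁ j = inj₂ (e , j)

  Step : Edge → Fin (suc k) → Rel V′ 0ℓ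
  Step e i a b = SamePair a b (path e (inject₁ i)) (path e (suc i))

  Adjacent : Rel V′ 0ℓ
  Adjacent a b = ∃[ e ] ∃[ i ] Step e i a b

  private
    path-inner : ∀ e i → path e (suc (inject₁ i)) ≡ inj₂ (e , i)
    path-inner e i rewrite view-inject₁ i = refl

    path-inner⁻ : ∀ e i {j} → path e (suc i) ≡ inj₂ (e , j) → i ≡ inject₁ j
    path-inner⁻ e i eq with view i
    path-inner⁻ e _ ()   | ‵fromℕ
    path-inner⁻ e _ refl | ‵inject₁ _ = refl

    path-branch⁻ : ∀ e i {x} → path e (suc i) ≡ inj₁ x → x ≡ target e
    path-branch⁻ e i eq with view i
    path-branch⁻ e _ refl | ‵fromℕ     = refl
    path-branch⁻ e _ ()   | ‵inject₁ _

    path-step : ∀ e i → path e (inject₁ i) ≢ path e (suc i)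
    path-step e zero eq = source≢target e (path-branch⁻ e zero (sym eq))
    path-step e (suc i) eq =
      ℕ.1+n≢n (trans (cong Fin.toℕ (path-inner⁻ e (suc i) (trans (sym eq) (path-inner e i))))
                     (Fin.toℕ-inject₁ i))

  subdivided : Graph
  subdivided = record
    { Vertex   = V′
    ; finite   = V′-finite
    ; _~_      = Adjacent
    ; ~-sym    = λ (e , i , s) → e , i , samePair-swap s
    ; ~-irrefl = λ { refl (e , i , inj₁ (p , q)) → path-step e i (trans (sym p) q)
                   ; refl (e , i , inj₂ (p , q)) → path-step e i (trans (sym q) p) }
    ; _~?_     = λ a b → Finite.any? edge-finite λ e → Fin.any? λ i →
        samePair? (Finite._≟_ V′-finite) a b (path e (inject₁ i)) (path e (suc i))
    }

open Subdivision public using () renaming (subdivided to subdivide)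

{-# OPTIONS --safe #-}

-- Label the coordinates by the vertices x of H and the ordered pairs (x , y) of adjacent ones, and
-- place a branch vertex x at the constant tuple x. A path replacing xy starts by writing (x , y) into
-- one coordinate dir x y, then visits every coordinate once, writing y into it, except that
-- coordinate dir y x receives (y , x), and finally turns that coordinate into y: n + 2 steps. If the
-- visit to dir x y is not the first and the visit to dir y x not the last, the path is induced; and
-- paths that meet in x and leave it in different directions stay two coordinates apart. Such
-- directions exist at every vertex except v, which has n + 1 neighbours.
-- At v the modified edge makes up for the missing direction. After relabelling each coordinate,
-- a deleted edge joins the first inner vertices of two paths that leave v in the same direction,
-- while an added edge is the first step of a path from v, which changes several coordinates at once.
-- Without a modified edge, v would need n + 1 pairwise nonadjacent neighbours.
module Submission where

open import Defs
open import Data.Bool.Base using (if_then_else_; true; false)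
open import Data.Empty using (⊥)
open import Data.Fin.Base as Fin
  using (Fin; zero; suc; fromℕ; fromℕ<; toℕ; inject₁; inject≤; punchIn)
open import Data.Fin.Permutation as Perm
  using (Permutation′; _⟨$⟩ʳ_; _⟨$⟩ˡ_; _∘ₚ_; transpose)
import Data.Fin.Properties as Fin
open import Data.Fin.Relation.Unary.Top using (view; view-fromℕ; view-inject₁; ‵fromℕ; ‵inject₁)
open import Data.Irrelevant using ([_])
open import Data.List.Base as List using (List; _∷_; filter)
import Data.List.Extrema.Nat as Extrema
open import Data.List.Membership.Propositional.Properties
  using (∈-map⁺; ∈-filter⁺; ∈-filter⁻; ∈-lookup)
import Data.List.Relation.Unary.All as All
open import Data.List.Relation.Unary.AllPairs using (_∷_)
import Data.List.Relation.Unary.Any as Any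
import Data.List.Relation.Unary.Any.Properties as Any
open import Data.List.Relation.Unary.Unique.Propositional using (Unique)
import Data.List.Relation.Unary.Unique.Propositional.Properties as Unique
open import Data.Nat.Base using (ℕ; zero; suc; _+_; _∸_; _≤_; _<_; s≤s; z≤n; s≤s⁻¹)
import Data.Nat.Properties as ℕ
open import Data.Product using (∃!)
open import Data.Product.Base using (_×_; _,_; ∃-syntax; Σ-syntax; proj₁; proj₂)
open import Data.Refinement using (Refinement; value) renaming (_,_ to _‖_)
open import Data.Refinement.Properties using (value-injective)
open import Data.Sum.Base as Sum using (_⊎_; inj₁; inj₂; [_,_]′)
open import Data.Sum.Properties using (inj₂-injective)
open import Data.Vec.Base as Vec using (Vec; lookup; tabulate)
import Data.Vec.Properties as Vec
open import Function.Base using (_∘_)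
open import Function.Bundles using (_⇔_; mk⇔; mk↔ₛ′; Equivalence; Injection)
open import Function.Definitions using (Injective)
open import Function.Properties.Inverse using (↔⇒↣)
open import Level using (0ℓ)
open import Relation.Binary.Definitions using (tri<; tri≈; tri>)
open import Relation.Binary.PropositionalEquality
  using (_≡_; _≢_; _≗_; refl; sym; trans; cong; cong₂; subst; subst₂)
open import Relation.Nullary using (¬_; Dec; yes; no; contradiction; ¬?; _×-dec_; _⊎-dec_)
open import Relation.Nullary.Decidable using (recompute; dec-true; dec-false; does; decidable-stable)
open import Relation.Unary using (Pred; Decidable)

open Graph using (Vertex)

-- Induced subgraphs as embeddings.

embedding⇒⊆ᴵ : ∀ H G (f : Graph.Vertex H → Graph.Vertex G) → Injective _≡_ _≡_ f →
  (∀ x y → Graph._~_ H x y ⇔ Graph._~_ G (f x) (f y)) → H ⊆ᴵ G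
embedding⇒⊆ᴵ H G f f-inj f-adj = Image , image? , record
  { bijection = mk↔ₛ′ to from
      (λ { (y ‖ [ p ]) → value-injective (proj₂ (preimage y p)) })
      (λ x → f-inj (proj₂ (preimage (f x) (x , refl))))
  ; adjacent⇔ = f-adj
  }
  where
  module H = Graph H
  module G = Graph G

  Image : G.Vertex → Set
  Image y = ∃[ x ] f x ≡ y

  image? : Decidable Image
  image? y = H.any? (λ x → f x G.≟ y)

  -- Membership in the image is stored irrelevantly, so a preimage has to be found again by
  -- searching the finite vertex set.
  preimage : ∀ y → .(Image y) → Image y
  preimage y p = recompute (image? y) p

  to : H.Vertex → Refinement G.Vertex Image
  to x = f x ‖ [ x , refl ]

  from : Refinement G.Vertex Image → H.Vertex
  from (y ‖ [ p ]) = proj₁ (preimage y p)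

⊆ᴵ⇒embedding : ∀ H G → H ⊆ᴵ G →
  ∃[ f ] (Injective _≡_ _≡_ f × (∀ x y → Graph._~_ H x y ⇔ Graph._~_ G (f x) (f y)))
⊆ᴵ⇒embedding H G (_ , _ , iso) =
  value ∘ to , Injection.injective (↔⇒↣ bijection) ∘ value-injective , adjacent⇔
  where open _≅_ iso

-- Permutations with prescribed or forbidden values.

transpose-left : ∀ {n} (i j : Fin n) → transpose i j ⟨$⟩ʳ i ≡ j
transpose-left i j rewrite dec-true (i Fin.≟ i) refl = refl

transpose-other : ∀ {n} {i j k : Fin n} → k ≢ i → k ≢ j → transpose i j ⟨$⟩ʳ k ≡ k
transpose-other {i = i} {j} {k} k≢i k≢j
  rewrite dec-false (k Fin.≟ i) k≢i | dec-false (k Fin.≟ j) k≢j = refl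

⟨$⟩ʳ-injective : ∀ {n} (π : Permutation′ n) → Injective _≡_ _≡_ (π ⟨$⟩ʳ_)
⟨$⟩ʳ-injective π = Injection.injective (↔⇒↣ π)

-- First exchange `i` and `p`, then move the image of `j` to `q`. The second transposition fixes
-- `p`, which differs from `q` and, by injectivity, from the image of `j`.
permutation-through₂ : ∀ {n} {i j p q : Fin n} → i ≢ j → p ≢ q →
  ∃[ π ] (π ⟨$⟩ʳ i ≡ p × π ⟨$⟩ʳ j ≡ q)
permutation-through₂ {i = i} {j} {p} {q} i≢j p≢q =
  σ ∘ₚ transpose j′ q ,
  trans (cong (transpose j′ q ⟨$⟩ʳ_) σi≡p) (transpose-other p≢j′ p≢q) ,
  transpose-left j′ q
  where
  σ = transpose i p
  j′ = σ ⟨$⟩ʳ j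
  σi≡p = transpose-left i p

  p≢j′ : p ≢ j′
  p≢j′ p≡j′ = i≢j (⟨$⟩ʳ-injective σ (trans σi≡p p≡j′))

two-avoiding : ∀ {n} → 3 ≤ n → (i j : Fin n) → ∃[ x ] ∃[ y ] (x ≢ y × i ≢ x × j ≢ y)
two-avoiding (s≤s (s≤s (s≤s z≤n))) i j with i Fin.≟ j
... | no i≢j = j , i , i≢j ∘ sym , i≢j , i≢j ∘ sym
... | yes refl = punchIn i zero , punchIn i (suc zero) ,
  Fin.0≢1+n ∘ Fin.punchIn-injective i zero (suc zero) ,
  Fin.punchInᵢ≢i i zero ∘ sym , Fin.punchInᵢ≢i i (suc zero) ∘ sym

abstract
  -- Some `x` other than `i` is sent to the first place and some `y` other than `j` to the last.
  -- This will order the visits to the coordinates along a path.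
  permutation-avoiding-ends : ∀ {n} → 3 ≤ n → (i j : Fin n) →
    Σ[ π ∈ Permutation′ n ] (toℕ (π ⟨$⟩ʳ i) ≢ 0 × suc (toℕ (π ⟨$⟩ʳ j)) ≢ n)
  permutation-avoiding-ends {suc (suc (suc m))} 3≤n@(s≤s (s≤s (s≤s z≤n))) i j
    with two-avoiding 3≤n i j
  ... | x , y , x≢y , i≢x , j≢y
    with permutation-through₂ x≢y (Fin.0≢1+n {i = fromℕ (1 + m)})
  ... | π , πx , πy = π ,
    (λ eq → i≢x (⟨$⟩ʳ-injective π (trans (Fin.toℕ-injective eq) (sym πx)))) ,
    (λ eq → j≢y (⟨$⟩ʳ-injective π (trans
      (Fin.toℕ-injective (trans (ℕ.suc-injective eq) (sym (Fin.toℕ-fromℕ (2 + m))))) (sym πy))))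

-- Labels, and tuples that differ in one or in several coordinates.

Label : Set → Set
Label V = V ⊎ (V × V)

pattern vert x  = inj₁ x
pattern arc x y = inj₂ (x , y)

-- The labels that may occur on the path replacing the edge between `u` and `w`. Two paths can agree
-- in a coordinate only where these sets meet.
data Owned {V : Set} (u w : V) : Label V → Set where
  vertˡ : Owned u w (vert u)
  vertʳ : Owned u w (vert w)
  arcˡ  : Owned u w (arc u w)
  arcʳ  : Owned u w (arc w u)

owned-swap : ∀ {V : Set} {u w : V} {ℓ} → Owned u w ℓ → Owned w u ℓ
owned-swap vertˡ = vertʳ
owned-swap vertʳ = vertˡ
owned-swap arcˡ  = arcʳ
owned-swap arcʳ  = arcˡ

owned-arc : ∀ {V : Set} {u w x y : V} → Owned u w (arc x y) → SamePair x y u w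
owned-arc arcˡ = inj₁ (refl , refl)
owned-arc arcʳ = inj₂ (refl , refl)

module _ {A : Set} {n : ℕ} where

  Differ : (P Q : Fin n → A) → Pred (Fin n) 0ℓ
  Differ P Q c = P c ≢ Q c

  DifferOnce : (P Q : Fin n → A) → Set
  DifferOnce P Q = ∃! _≡_ (Differ P Q)

  -- Two distinct witnesses rule out both equality and adjacency in the product.
  Far : (P Q : Fin n → A) → Set
  Far P Q = ∃[ c ] ∃[ c′ ] (c ≢ c′ × Differ P Q c × Differ P Q c′)

  far-sym : ∀ {P Q} → Far P Q → Far Q P
  far-sym (c , c′ , c≢c′ , d , d′) = c , c′ , c≢c′ , d ∘ sym , d′ ∘ sym

  differOnce-sym : ∀ {P Q} → DifferOnce P Q → DifferOnce Q P
  differOnce-sym (c , d , u) = c , d ∘ sym , λ d′ → u (d′ ∘ sym)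

  everywhere⇒far : 2 ≤ n → ∀ {P Q} → (∀ c → Differ P Q c) → Far P Q
  everywhere⇒far (s≤s (s≤s z≤n)) d = zero , suc zero , (λ ()) , d zero , d (suc zero)

-- The walk through tuples of labels that replaces one edge.

module Route {V : Set} {n : ℕ} (3≤n : 3 ≤ n) {u w : V} (u≢w : u ≢ w)
  {E : Pred (Fin n) 0ℓ} (E? : Decidable E) {a : Fin n} (Ea : E a) (b : Fin n) where

  private
    N : ℕ
    N = 2 + n

    -- The coordinate `a` must not be visited first, nor `b` last.
    schedule = permutation-avoiding-ends 3≤n a b
    π = proj₁ schedule

    -- Time 1 is taken by the first step, which changes all of `E`. The visits fill the times 2 to n
    -- + 1, and time `N` is left for `b` to become `vert w`.
    turn : Fin n → ℕ
    turn c = 2 + toℕ (π ⟨$⟩ʳ c)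

    turning : Fin n → Fin n
    turning = π ⟨$⟩ˡ_

    turn-turning : ∀ i → turn (turning i) ≡ 2 + toℕ i
    turn-turning i = cong (λ j → 2 + toℕ j) (Perm.inverseʳ π)

    turn<N : ∀ c → turn c < N
    turn<N c = s≤s (s≤s (Fin.toℕ<n (π ⟨$⟩ʳ c)))

    turn-b : turn b ≤ n
    turn-b = ℕ.≤∧≢⇒< (Fin.toℕ<n (π ⟨$⟩ʳ b)) (proj₂ (proj₂ schedule))

    departed : Fin n → Label V
    departed c = if does (E? c) then arc u w else vert u

    arrived : ℕ → Fin n → Label V
    arrived t c = if does ((c Fin.≟ b) ×-dec (t ℕ.<? N)) then arc w u else vert w

  route : ℕ → Fin n → Label V
  route zero    c = vert u
  route (suc t) c = if does (suc t ℕ.<? turn c) then departed c else arrived (suc t) c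

  private
    departed-yes : ∀ {c} → E c → departed c ≡ arc u w
    departed-yes {c} e rewrite dec-true (E? c) e = refl

    departed-no : ∀ {c} → ¬ E c → departed c ≡ vert u
    departed-no {c} e rewrite dec-false (E? c) e = refl

    arrived-yes : ∀ {t} → t < N → arrived t b ≡ arc w u
    arrived-yes {t} p rewrite dec-true ((b Fin.≟ b) ×-dec (t ℕ.<? N)) (refl , p) = refl

    arrived-no : ∀ {t c} → ¬ (c ≡ b × t < N) → arrived t c ≡ vert w
    arrived-no {t} {c} p rewrite dec-false ((c Fin.≟ b) ×-dec (t ℕ.<? N)) p = refl

    departed-owned : ∀ c → Owned u w (departed c)
    departed-owned c with does (E? c)
    ... | true  = arcˡ
    ... | false = vertˡ

    arrived-owned : ∀ t c → Owned u w (arrived t c)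
    arrived-owned t c with does ((c Fin.≟ b) ×-dec (t ℕ.<? N))
    ... | true  = arcʳ
    ... | false = vertʳ

    departed≢vert : ∀ c → departed c ≢ vert w
    departed≢vert c eq with does (E? c)
    departed≢vert c ()   | true
    departed≢vert c refl | false = u≢w refl

    vert≢arrived : ∀ t c → vert u ≢ arrived t c
    vert≢arrived t c eq with does ((c Fin.≟ b) ×-dec (t ℕ.<? N))
    vert≢arrived t c ()   | true
    vert≢arrived t c refl | false = u≢w refl

    departed≢arrived : ∀ t c → departed c ≢ arrived t c
    departed≢arrived t c eq with does (E? c) | does ((c Fin.≟ b) ×-dec (t ℕ.<? N))
    departed≢arrived t c refl | true  | true  = u≢w refl
    departed≢arrived t c ()   | true  | false
    departed≢arrived t c ()   | false | true
    departed≢arrived t c refl | false | false = u≢w refl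

    early : ∀ {t c} → suc t < turn c → route (suc t) c ≡ departed c
    early {t} {c} p rewrite dec-true (suc t ℕ.<? turn c) p = refl

    late : ∀ {t c} → turn c ≤ t → route t c ≡ arrived t c
    late {suc t} {c} p rewrite dec-false (suc t ℕ.<? turn c) (ℕ.≤⇒≯ p) = refl

    phase : ∀ t c → route (suc t) c ≡ departed c ⊎ route (suc t) c ≡ arrived (suc t) c
    phase t c with does (suc t ℕ.<? turn c)
    ... | true  = inj₁ refl
    ... | false = inj₂ refl

    -- Before its turn a coordinate holds `vert u` or `arc u w`, afterwards `arc w u` or `vert w`,
    -- and these four labels are distinct.
    early-late : ∀ {t t′ c} → t < turn c → turn c ≤ t′ → route t c ≢ route t′ c
    early-late {zero}  {t′} {c} p q eq = vert≢arrived t′ c (trans eq (late q))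
    early-late {suc t} {t′} {c} p q eq =
      departed≢arrived t′ c (trans (sym (early p)) (trans eq (late q)))

    arrived-stage : ∀ {t c} → t < N → arrived t c ≢ arrived (suc t) c →
      turn c ≡ suc t ⊎ (c ≡ b × suc t ≡ N)
    arrived-stage {t} {c} t<N d with c Fin.≟ b | ℕ.m≤n⇒m<n∨m≡n t<N
    ... | yes c≡b  | inj₂ eq    = inj₂ (c≡b , eq)
    ... | no  _    | _          = contradiction refl d
    ... | yes refl | inj₁ t+1<N
      rewrite dec-true (t ℕ.<? N) t<N | dec-true (suc t ℕ.<? N) t+1<N = contradiction refl d

    -- Coordinate b pauses at its turn and only arrives with the last step.
    stage : ∀ {t c} → 1 ≤ t → t < N → Differ (route t) (route (suc t)) c →
      turn c ≡ suc t ⊎ (c ≡ b × suc t ≡ N)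
    stage {suc t} {c} _ t<N d with ℕ.<-cmp (turn c) (2 + t)
    ... | tri≈ _ eq _ = inj₁ eq
    ... | tri> _ _ gt = contradiction (trans (early (ℕ.<⇒≤ gt)) (sym (early gt))) d
    ... | tri< lt _ _ = arrived-stage t<N λ eq →
      d (trans (late (s≤s⁻¹ lt)) (trans eq (sym (late (ℕ.<⇒≤ lt)))))

    turning-at : ∀ {t} → 1 ≤ t → t ≤ n → ∃[ c ] turn c ≡ suc t
    turning-at {suc t} _ t≤n = turning (fromℕ< t≤n) ,
      trans (turn-turning (fromℕ< t≤n)) (cong (2 +_) (Fin.toℕ-fromℕ< t≤n))

    turn-injective : ∀ {c c′} → turn c ≡ turn c′ → c ≡ c′
    turn-injective eq = ⟨$⟩ʳ-injective π (Fin.toℕ-injective (ℕ.suc-injective (ℕ.suc-injective eq)))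

    last-differ : ∀ {t} → turn b ≤ t → t < N → Differ (route t) (route N) b
    last-differ {t} p t<N eq with trans (sym (arrived-yes t<N)) (trans (sym (late {t} p))
      (trans eq (trans (late {N} (ℕ.<⇒≤ (turn<N b))) (arrived-no {N} {b} (ℕ.<-irrefl refl ∘ proj₂)))))
    ... | ()

  owned : ∀ t c → Owned u w (route t c)
  owned zero    c = vertˡ
  owned (suc t) c with does (suc t ℕ.<? turn c)
  ... | true  = departed-owned c
  ... | false = arrived-owned (suc t) c

  route-end : route N ≗ (λ _ → vert w)
  route-end c = trans (late (ℕ.<⇒≤ (turn<N c))) (arrived-no {N} {c} (ℕ.<-irrefl refl ∘ proj₂))

  route-first : route 1 ≗ (λ c → if does (E? c) then arc u w else vert u)
  route-first c = early {0} (s≤s (s≤s z≤n))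

  route-first-no : ∀ {c} → ¬ E c → route 1 c ≡ vert u
  route-first-no {c} ¬e = trans (early {0} {c} (s≤s (s≤s z≤n))) (departed-no ¬e)

  leaves : ∀ {t c} → 1 ≤ t → E c → route t c ≢ vert u
  leaves {suc t} {c} _ e eq with phase t c
  ... | inj₁ p with trans (sym (departed-yes e)) (trans (sym p) eq)
  ...   | ()
  leaves {suc t} {c} _ e eq | inj₂ p = vert≢arrived (suc t) c (trans (sym eq) p)

  -- The coordinate visited first serves, and the schedule makes it different from `a`.
  left : ∀ {t} → 2 ≤ t → ∃[ c ] (a ≢ c × route t c ≢ vert u)
  left {t} 2≤t = first ,
    (λ a≡first → proj₁ (proj₂ schedule) (trans (cong (toℕ ∘ (π ⟨$⟩ʳ_)) a≡first) first-first)) ,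
    (λ eq → vert≢arrived t first (sym (trans (sym (late first≤t)) eq)))
    where
    0<n : 0 < n
    0<n = ℕ.≤-trans (s≤s z≤n) 3≤n

    first : Fin n
    first = turning (fromℕ< 0<n)

    first-first : toℕ (π ⟨$⟩ʳ first) ≡ 0
    first-first = trans (cong toℕ (Perm.inverseʳ π)) (Fin.toℕ-fromℕ< 0<n)

    first≤t : turn first ≤ t
    first≤t = subst (_≤ t) (cong (2 +_) (sym first-first)) 2≤t

  -- This does for the end `w` what `leaves` does for `u`: one fixed coordinate tells every inner
  -- position from that end.
  approaches : ∀ {t} → t < N → route t b ≢ vert w
  approaches {zero}  _ refl = u≢w refl
  approaches {suc t} t<N eq with phase t b
  ... | inj₁ p = departed≢vert b (trans (sym p) eq)
  ... | inj₂ p with trans (sym (arrived-yes t<N)) (trans (sym p) eq)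
  ...   | ()

  -- The first step is left out, as it changes all of `E` at once. Each later step but the last is
  -- the visit to a single coordinate.
  differOnce : ∀ {t} → 1 ≤ t → t < N → DifferOnce (route t) (route (suc t))
  differOnce {t} 1≤t t<N with ℕ.m≤n⇒m<n∨m≡n (s≤s⁻¹ t<N)
  ... | inj₁ t<n+1 with turning-at 1≤t (s≤s⁻¹ t<n+1)
  ...   | c , eq = c , early-late (ℕ.≤-reflexive (sym eq)) (ℕ.≤-reflexive eq) , λ d →
    [ (λ eq′ → turn-injective (trans eq (sym eq′)))
    , (λ (_ , t+1≡N) → contradiction (ℕ.suc-injective t+1≡N) (ℕ.<⇒≢ t<n+1)) ]′ (stage 1≤t t<N d)
  -- The last step only turns `arc w u` into `vert w` in coordinate `b`.
  differOnce {t} 1≤t t<N | inj₂ refl = b , last-differ (ℕ.≤-trans turn-b (ℕ.n≤1+n n)) ℕ.≤-refl , λ {c} d →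
    [ (λ eq → contradiction eq (ℕ.<⇒≢ (turn<N c))) , sym ∘ proj₁ ]′ (stage 1≤t t<N d)

  -- From time 0 the witnesses are `a` and the coordinate visited first. Later they are the
  -- coordinates of the next two visits. At time n only one visit remains, and the second witness is
  -- `b`, which has been visited by then and changes again in the last step.
  far : ∀ {t t′} → suc t < t′ → t′ ≤ N → Far (route t) (route t′)
  far {zero} {t′} t<t′ t′≤N with left t<t′
  ... | c , a≢c , r = a , c , a≢c , leaves (ℕ.<⇒≤ t<t′) Ea ∘ sym , r ∘ sym
  far {suc t} {t′} t<t′ t′≤N
    with turning-at (s≤s z≤n) (s≤s⁻¹ (s≤s⁻¹ (ℕ.≤-trans t<t′ t′≤N)))
  ... | c , eq with ℕ.m≤n⇒m<n∨m≡n (s≤s⁻¹ (s≤s⁻¹ (ℕ.≤-trans t<t′ t′≤N)))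
  ...   | inj₁ t+1<n with turning-at {2 + t} (s≤s z≤n) t+1<n
  ...     | c′ , eq′ = c , c′ ,
    (λ c≡c′ → ℕ.1+n≢n (trans (sym eq′) (trans (cong turn (sym c≡c′)) eq))) ,
    early-late (ℕ.≤-reflexive (sym eq)) (ℕ.≤-trans (ℕ.≤-reflexive eq) (ℕ.<⇒≤ t<t′)) ,
    early-late (ℕ.≤-trans (ℕ.n≤1+n _) (ℕ.≤-reflexive (sym eq′))) (ℕ.≤-trans (ℕ.≤-reflexive eq′) t<t′)
  far {suc t} {t′} t<t′ t′≤N | c , eq | inj₂ refl with ℕ.≤-antisym t′≤N t<t′
  ... | refl = c , b ,
    (λ c≡b → ℕ.<⇒≱ (ℕ.≤-reflexive (sym eq)) (subst (λ c → turn c ≤ n) (sym c≡b) turn-b)) ,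
    early-late (ℕ.≤-reflexive (sym eq)) (ℕ.≤-trans (ℕ.≤-reflexive eq) (ℕ.<⇒≤ t<t′)) ,
    last-differ turn-b (ℕ.n≤1+n _)

-- Pointwise equal tuples, and labels owned by two edges.

module _ {A : Set} {n : ℕ} {P P′ Q Q′ : Fin n → A} (p : P ≗ P′) (q : Q ≗ Q′) where

  differ-resp : ∀ {c} → Differ P Q c → Differ P′ Q′ c
  differ-resp {c} d eq = d (trans (p c) (trans eq (sym (q c))))

  far-resp : Far P Q → Far P′ Q′
  far-resp (c , c′ , c≢c′ , d , d′) = c , c′ , c≢c′ , differ-resp d , differ-resp d′

differOnce-resp : ∀ {A : Set} {n} {P P′ Q Q′ : Fin n → A} → P ≗ P′ → Q ≗ Q′ →
  DifferOnce P Q → DifferOnce P′ Q′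
differOnce-resp p q (c , d , u) =
  c , differ-resp p q d , λ d′ → u (differ-resp (sym ∘ p) (sym ∘ q) d′)

owned-samePair : ∀ {V : Set} {x y s t : V} {ℓ} → SamePair x y s t → Owned s t ℓ → Owned x y ℓ
owned-samePair (inj₁ (refl , refl)) o = o
owned-samePair (inj₂ (refl , refl)) o = owned-swap o

owned-common : ∀ {V : Set} {x y z : V} {ℓ} → y ≢ z → Owned x y ℓ → Owned x z ℓ → ℓ ≡ vert x
owned-common y≢z vertˡ _     = refl
owned-common y≢z vertʳ vertˡ = refl
owned-common y≢z vertʳ vertʳ = contradiction refl y≢z
owned-common y≢z arcˡ  arcˡ  = contradiction refl y≢z
owned-common y≢z arcˡ  arcʳ  = contradiction refl y≢z
owned-common y≢z arcʳ  arcˡ  = contradiction refl y≢z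
owned-common y≢z arcʳ  arcʳ  = contradiction refl y≢z

owned-disjoint : ∀ {V : Set} {u w x y : V} {ℓ} → u ≢ x → u ≢ y → w ≢ x → w ≢ y →
  Owned u w ℓ → ¬ Owned x y ℓ
owned-disjoint ux uy wx wy vertˡ vertˡ = ux refl
owned-disjoint ux uy wx wy vertˡ vertʳ = uy refl
owned-disjoint ux uy wx wy vertʳ vertˡ = wx refl
owned-disjoint ux uy wx wy vertʳ vertʳ = wy refl
owned-disjoint ux uy wx wy arcˡ  arcˡ  = ux refl
owned-disjoint ux uy wx wy arcˡ  arcʳ  = uy refl
owned-disjoint ux uy wx wy arcʳ  arcˡ  = wx refl
owned-disjoint ux uy wx wy arcʳ  arcʳ  = ux refl

-- Edges of the graph and paths of its subdivision.

module SubdivisionPaths (k : ℕ) (H : Graph) where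
  private module H = Graph H
  open Subdivision k H

  path-inner : ∀ e i → path e (suc (inject₁ i)) ≡ inj₂ (e , i)
  path-inner e i rewrite view-inject₁ i = refl

  path-last : ∀ e → path e (fromℕ (suc k)) ≡ inj₁ (target e)
  path-last e rewrite view-fromℕ k = refl

  path-consecutive : ∀ e {i j} → suc (toℕ i) ≡ toℕ j → Adjacent (path e i) (path e j)
  path-consecutive e {i} {suc j} eq = e , j , inj₁ (cong (path e) i≡j , refl)
    where
    i≡j : i ≡ inject₁ j
    i≡j = Fin.toℕ-injective (trans (ℕ.suc-injective eq) (sym (Fin.toℕ-inject₁ j)))

  edge-proof : ∀ e → IncreasingEdge (source e , target e)
  edge-proof ((x , y) ‖ [ p ]) = recompute (increasingEdge? (x , y)) p

  edge-adjacent : ∀ e {x y} → SamePair x y (source e) (target e) → x H.~ y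
  edge-adjacent e (inj₁ (refl , refl)) = proj₂ (edge-proof e)
  edge-adjacent e (inj₂ (refl , refl)) = H.~-sym (proj₂ (edge-proof e))

  edge-between : ∀ {x y} → x H.~ y → ∃[ e ] SamePair x y (source e) (target e)
  edge-between {x} {y} x~y with Fin.<-cmp (H.rank x) (H.rank y)
  ... | tri< lt _ _ = ((x , y) ‖ [ lt , x~y ]) , inj₁ (refl , refl)
  ... | tri≈ _ eq _ = contradiction x~y (H.~-irrefl (H.rank-injective eq))
  ... | tri> _ _ gt = ((y , x) ‖ [ gt , H.~-sym x~y ]) , inj₂ (refl , refl)

  -- Both edges increase in rank from source to target, so reversed ends would give opposite
  -- inequalities.
  no-reversal : ∀ e e′ → source e ≡ target e′ → target e ≢ source e′
  no-reversal e e′ p q = Fin.<-asym (proj₁ (edge-proof e))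
    (subst₂ (λ x y → H.rank x Fin.< H.rank y) (sym q) (sym p) (proj₁ (edge-proof e′)))

  edge-unique : ∀ {x y} e e′ → SamePair x y (source e) (target e) →
    SamePair x y (source e′) (target e′) → e ≡ e′
  edge-unique e e′ (inj₁ (refl , refl)) (inj₁ (p , q)) = value-injective (cong₂ _,_ p q)
  edge-unique e e′ (inj₂ (refl , refl)) (inj₂ (p , q)) = value-injective (cong₂ _,_ q p)
  edge-unique e e′ (inj₁ (refl , refl)) (inj₂ (p , q)) = contradiction q (no-reversal e e′ p)
  edge-unique e e′ (inj₂ (refl , refl)) (inj₁ (p , q)) = contradiction p (no-reversal e e′ q)

-- Drawing the subdivision in tuples of labels.

module Drawing (n : ℕ) (3≤n : 3 ≤ n) (H : Graph) (v w₀ : Vertex H)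
  (dir : Vertex H → Vertex H → Fin n)
  (dir-injective : ∀ {x y z} → x ≢ v → Graph._~_ H x y → Graph._~_ H x z →
    dir x y ≡ dir x z → y ≡ z)
  {D : Pred (Fin n) 0ℓ} (D? : Decidable D) where

  private
    module H = Graph H
    N : ℕ
    N = 2 + n

    V = H.Vertex

  open H using (_~_)
  open Subdivision (suc n) H using (Edge; source; target; path; V′; Adjacent)
  open SubdivisionPaths (suc n) H

  Position : Set
  Position = Fin n → Label V

  -- D is to be the set of coordinates in which the ends of the modified edge differ.
  Exit : V → V → Pred (Fin n) 0ℓ
  Exit u w c = c ≡ dir u w ⊎ (u ≡ v × w ≡ w₀) × D c

  exit? : ∀ u w → Decidable (Exit u w)
  exit? u w c = (c Fin.≟ dir u w) ⊎-dec (((u H.≟ v) ×-dec (w H.≟ w₀)) ×-dec D? c)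

  origin : Position
  origin _ = vert v

  -- The tuple reached by the first step from `v` towards `w`.
  launch : V → Position
  launch w c = if does (exit? v w c) then arc v w else vert v

  launch-yes : ∀ {w c} → Exit v w c → launch w c ≡ arc v w
  launch-yes {w} {c} e rewrite dec-true (exit? v w c) e = refl

  launch-no : ∀ {w c} → ¬ Exit v w c → launch w c ≡ vert v
  launch-no {w} {c} ¬e rewrite dec-false (exit? v w c) ¬e = refl

  -- The label `arc v w` names its edge, so it cannot occur in `launch w′`.
  launch-differˡ : ∀ {w w′ c} → w ≢ w′ → Exit v w c → Differ (launch w) (launch w′) c
  launch-differˡ {w} {w′} {c} w≢w′ e eq with exit? v w′ c
  ... | yes e′ with trans (sym (launch-yes e)) (trans eq (launch-yes e′))
  ...   | refl = w≢w′ refl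
  launch-differˡ {w} {w′} {c} w≢w′ e eq | no ¬e′
    with trans (sym (launch-yes e)) (trans eq (launch-no ¬e′))
  ... | ()

  Launch : V → Position → Position → Set
  Launch w P Q = P ≗ origin × Q ≗ launch w

  -- The step from `origin` to `launch w₀` may change several coordinates. That it becomes an edge
  -- is shown separately for an added and for a deleted edge.
  Linked : Position → Position → Set
  Linked P Q = DifferOnce P Q ⊎ Launch w₀ P Q ⊎ Launch w₀ Q P

  -- The one kind of pair that cannot be separated at this stage, since directions at `v` may
  -- coincide.
  Clash : Position → Position → Set
  Clash P Q = ∃[ y ] ∃[ z ] (v ~ y × v ~ z × y ≢ z × P ≗ launch y × Q ≗ launch z)

  linked-sym : ∀ {P Q} → Linked P Q → Linked Q P
  linked-sym = Sum.map differOnce-sym Sum.swap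

  linked-resp : ∀ {P P′ Q Q′} → P ≗ P′ → Q ≗ Q′ → Linked P Q → Linked P′ Q′
  linked-resp p q = Sum.map (differOnce-resp p q)
    (Sum.map (λ (o , l) → (λ c → trans (sym (p c)) (o c)) , λ c → trans (sym (q c)) (l c))
             (λ (o , l) → (λ c → trans (sym (q c)) (o c)) , λ c → trans (sym (p c)) (l c)))

  -- The fields about an end and its neighbour are stated for unordered pairs, so that they survive
  -- `reverse`. At `v`, `at-avoids-v` and `at-launched` together say that an inner position is the
  -- launch or has left `vert v` in two coordinates.
  record Track (s t : V) : Set where
    field
      at          : ℕ → Position
      at-start    : at 0 ≗ (λ _ → vert s)
      at-end      : at N ≗ (λ _ → vert t)
      at-owned    : ∀ i c → Owned s t (at i c)
      at-linked   : ∀ {i} → i < N → Linked (at i) (at (suc i))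
      at-far      : ∀ {i j} → suc i < j → j ≤ N → Far (at i) (at j)
      at-avoids   : ∀ {x y i} → SamePair x y s t → x ≢ v → 0 < i → i < N → at i (dir x y) ≢ vert x
      at-avoids-v : ∀ {y i} → SamePair v y s t → 0 < i → i < N → at i (dir v y) ≢ vert v
      at-launched : ∀ {y i} → SamePair v y s t → 0 < i → i < N →
        at i ≗ launch y ⊎ ∃[ c ] (dir v y ≢ c × at i c ≢ vert v)
      at-launches : ∀ {y} → SamePair v y s t →
        ∃[ i ] (i < N × (Launch y (at i) (at (suc i)) ⊎ Launch y (at (suc i)) (at i)))

  open Track

  forward : ∀ {s t} → s ~ t → t ≢ v → Track s t
  forward {s} {t} s~t t≢v = record
    { at          = route
    ; at-start    = λ _ → refl
    ; at-end      = route-end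
    ; at-owned    = owned
    ; at-linked   = linked
    ; at-far      = far
    ; at-avoids   = λ { (inj₁ (refl , refl)) _ 0<i _ → leaves 0<i (inj₁ refl)
                      ; (inj₂ (refl , refl)) _ _ i<N → approaches i<N }
    ; at-avoids-v = λ { (inj₁ (refl , refl)) 0<i _ → leaves 0<i (inj₁ refl)
                      ; (inj₂ (v≡t , _)) → contradiction (sym v≡t) t≢v }
    ; at-launched = launched
    ; at-launches = λ { (inj₁ (refl , refl)) → 0 , s≤s z≤n , inj₁ ((λ _ → refl) , route-first)
                      ; (inj₂ (v≡t , _)) → contradiction (sym v≡t) t≢v }
    }
    where
    open Route 3≤n (λ s≡t → H.~-irrefl s≡t s~t) (exit? s t) (inj₁ refl) (dir t s)

    linked : ∀ {i} → i < N → Linked (route i) (route (suc i))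
    linked {suc i} i<N = inj₁ (differOnce (s≤s z≤n) i<N)
    -- Unless the track runs from `v` to `w₀`, the set `Exit s t` consists of `dir s t` alone and
    -- the first step changes one coordinate.
    linked {zero}  _ with (s H.≟ v) ×-dec (t H.≟ w₀)
    ... | yes (refl , refl) = inj₂ (inj₁ ((λ _ → refl) , route-first))
    ... | no ¬special = inj₁ (dir s t , leaves {1} (s≤s z≤n) (inj₁ refl) ∘ sym , unique)
      where
      unique : ∀ {c} → Differ (route 0) (route 1) c → dir s t ≡ c
      unique {c} d with exit? s t c
      ... | yes (inj₁ c≡dir)         = sym c≡dir
      ... | yes (inj₂ (special , _)) = contradiction special ¬special
      ... | no ¬exit                 = contradiction (sym (route-first-no ¬exit)) d

    launched : ∀ {y i} → SamePair v y s t → 0 < i → i < N →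
      route i ≗ launch y ⊎ ∃[ c ] (dir v y ≢ c × route i c ≢ vert v)
    launched (inj₂ (v≡t , _)) = contradiction (sym v≡t) t≢v
    launched {i = 1} (inj₁ (refl , refl)) _ _ = inj₁ route-first
    launched {i = suc (suc i)} (inj₁ (refl , refl)) _ _ = inj₂ (left (s≤s (s≤s z≤n)))

  reverse : ∀ {s t} → Track s t → Track t s
  reverse {s} {t} τ = record
    { at          = λ i → at τ (N ∸ i)
    ; at-start    = at-end τ
    ; at-end      = λ c → trans (cong (λ i → at τ i c) (ℕ.n∸n≡0 N)) (at-start τ c)
    ; at-owned    = λ i c → owned-swap (at-owned τ (N ∸ i) c)
    ; at-linked   = λ {i} i<N → linked-sym
        (subst (λ j → Linked (at τ (N ∸ suc i)) (at τ j)) (step i<N) (at-linked τ (back (s≤s z≤n) i<N)))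
    ; at-far      = λ {i} {j} i<j j≤N → far-sym (at-far τ
        (subst (_≤ N ∸ i) (ℕ.+-∸-assoc 2 j≤N) (ℕ.∸-monoʳ-≤ (2 + N) i<j)) (ℕ.m∸n≤m N i))
    ; at-avoids   = λ p x≢v 0<i i<N → at-avoids τ (swap p) x≢v (ℕ.m<n⇒0<n∸m i<N) (back 0<i (ℕ.<⇒≤ i<N))
    ; at-avoids-v = λ p 0<i i<N → at-avoids-v τ (swap p) (ℕ.m<n⇒0<n∸m i<N) (back 0<i (ℕ.<⇒≤ i<N))
    ; at-launched = λ p 0<i i<N → at-launched τ (swap p) (ℕ.m<n⇒0<n∸m i<N) (back 0<i (ℕ.<⇒≤ i<N))
    ; at-launches = λ {y} p → launches (at-launches τ (swap p))
    }
    where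
    swap : ∀ {x y} → SamePair x y t s → SamePair x y s t
    swap (inj₁ (p , q)) = inj₂ (p , q)
    swap (inj₂ (p , q)) = inj₁ (p , q)

    step : ∀ {i} → i < N → suc (N ∸ suc i) ≡ N ∸ i
    step i<N = sym (ℕ.+-∸-assoc 1 i<N)

    back : ∀ {i} → 0 < i → i ≤ N → N ∸ i < N
    back 0<i i≤N = ℕ.∸-monoʳ-< 0<i i≤N

    Step : V → ℕ → ℕ → Set
    Step y i j = Launch y (at τ i) (at τ j) ⊎ Launch y (at τ j) (at τ i)

    launches : ∀ {y} → ∃[ i ] (i < N × Step y i (suc i)) → ∃[ i ] (i < N × Step y (N ∸ i) (N ∸ suc i))
    launches {y} (i , i<N , l) = N ∸ suc i , back (s≤s z≤n) i<N , Sum.swap (subst₂ (Step y)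
      (trans (sym (ℕ.m∸[m∸n]≡n (ℕ.<⇒≤ i<N))) (cong (N ∸_) (sym (step i<N))))
      (sym (ℕ.m∸[m∸n]≡n i<N)) l)

  -- Edges at v are routed away from v, so that their first step can be prescribed.
  track : ∀ e → Track (source e) (target e)
  track e with target e H.≟ v
  ... | no t≢v  = forward (edge-adjacent e (inj₁ (refl , refl))) t≢v
  ... | yes t≡v = reverse (forward t~s (λ s≡v → H.~-irrefl (trans t≡v (sym s≡v)) t~s))
    where t~s = edge-adjacent e (inj₂ (refl , refl))

  pos : V′ → Position
  pos (inj₁ x)       = λ _ → vert x
  pos (inj₂ (e , j)) = at (track e) (suc (toℕ j))

  pos-path : ∀ e i → pos (path e i) ≗ at (track e) (toℕ i)
  pos-path e zero c = sym (at-start (track e) c)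
  pos-path e (suc i) c with view i
  ... | ‵inject₁ j = cong (λ k → at (track e) (suc k) c) (sym (Fin.toℕ-inject₁ j))
  ... | ‵fromℕ     = trans (sym (at-end (track e) c))
    (cong (λ k → at (track e) (suc k) c) (sym (Fin.toℕ-fromℕ (suc n))))

  -- Classifying all pairs in this way leaves only adjacent pairs and clashes to be examined once
  -- the modified edge is known.
  Placed : V′ → V′ → Set
  Placed a b = a ≡ b ⊎ Adjacent a b ⊎ Far (pos a) (pos b) ⊎ Clash (pos a) (pos b)

  adjacent-sym : ∀ {a b} → Adjacent a b → Adjacent b a
  adjacent-sym = Graph.~-sym (subdivide (suc n) H)

  placed-sym : ∀ {a b} → Placed a b → Placed b a
  placed-sym = Sum.map sym (Sum.map adjacent-sym (Sum.map far-sym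
    λ (y , z , v~y , v~z , y≢z , p , q) → z , y , v~z , v~y , y≢z ∘ sym , q , p))

  adjacent-linked : ∀ {a b} → Adjacent a b → Linked (pos a) (pos b)
  adjacent-linked (e , i , s) = oriented s
    where
    step : Linked (pos (path e (inject₁ i))) (pos (path e (suc i)))
    step = linked-resp
      (λ c → trans (cong (λ k → at (track e) k c) (sym (Fin.toℕ-inject₁ i)))
                   (sym (pos-path e (inject₁ i) c)))
      (sym ∘ pos-path e (suc i))
      (at-linked (track e) (Fin.toℕ<n i))

    oriented : ∀ {a b} → SamePair a b (path e (inject₁ i)) (path e (suc i)) → Linked (pos a) (pos b)
    oriented (inj₁ (refl , refl)) = step
    oriented (inj₂ (refl , refl)) = linked-sym step

  path-owned : ∀ e i c → Owned (source e) (target e) (pos (path e i) c)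
  path-owned e i c = subst (Owned _ _) (sym (pos-path e i c)) (at-owned (track e) (toℕ i) c)

  adjacent-owned : ∀ {a b} → Adjacent a b → ∃[ s ] ∃[ t ]
    ((∀ c → Owned s t (pos a c)) × (∀ c → Owned s t (pos b c)))
  adjacent-owned (e , i , inj₁ (refl , refl)) =
    _ , _ , path-owned e (inject₁ i) , path-owned e (suc i)
  adjacent-owned (e , i , inj₂ (refl , refl)) =
    _ , _ , path-owned e (suc i) , path-owned e (inject₁ i)

  path-placed< : ∀ e {i j} → toℕ i < toℕ j → Placed (path e i) (path e j)
  path-placed< e {i} {j} i<j with ℕ.m≤n⇒m<n∨m≡n i<j
  ... | inj₂ eq   = inj₂ (inj₁ (path-consecutive e eq))
  ... | inj₁ i+1<j = inj₂ (inj₂ (inj₁ (far-resp (sym ∘ pos-path e i) (sym ∘ pos-path e j)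
    (at-far (track e) i+1<j (Fin.toℕ≤pred[n] j)))))

  path-placed : ∀ e i j → Placed (path e i) (path e j)
  path-placed e i j with ℕ.<-cmp (toℕ i) (toℕ j)
  ... | tri< lt _ _ = path-placed< e lt
  ... | tri≈ _ eq _ = inj₁ (cong (path e) (Fin.toℕ-injective eq))
  ... | tri> _ _ gt = placed-sym (path-placed< e gt)

  branch-placed : ∀ x y → Placed (inj₁ x) (inj₁ y)
  branch-placed x y with x H.≟ y
  ... | yes refl = inj₁ refl
  ... | no x≢y   = inj₂ (inj₂ (inj₁ (everywhere⇒far (ℕ.<⇒≤ 3≤n) λ _ → differ)))
    where
    differ : _≢_ {A = Label V} (vert x) (vert y)
    differ refl = x≢y refl

  mixed-placed : ∀ x e j → Placed (inj₁ x) (inj₂ (e , j))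
  mixed-placed x e j with x H.≟ source e | x H.≟ target e
  ... | yes refl | _ =
    subst (Placed (inj₁ x)) (path-inner e j) (path-placed e zero (suc (inject₁ j)))
  ... | no _ | yes refl = subst (λ a → Placed a (inj₂ (e , j))) (path-last e)
    (subst (Placed (path e (fromℕ (2 + n)))) (path-inner e j)
      (path-placed e (fromℕ (2 + n)) (suc (inject₁ j))))
  ... | no x≢s | no x≢t =
    inj₂ (inj₂ (inj₁ (everywhere⇒far (ℕ.<⇒≤ 3≤n) differ)))
    where
    foreign : ∀ {ℓ} → Owned (source e) (target e) ℓ → vert x ≢ ℓ
    foreign vertˡ refl = x≢s refl
    foreign vertʳ refl = x≢t refl
    foreign arcˡ  ()
    foreign arcʳ  ()

    differ : ∀ c → vert x ≢ pos (inj₂ (e , j)) c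
    differ c = foreign (at-owned (track e) (suc (toℕ j)) c)

  -- Labels owned by two edges with one common end x agree only in `vert x`, so every coordinate
  -- where either tuple has left `vert x` is a difference. Edges without a common end share no label
  -- at all.
  inner-placed : ∀ {e e′} → e ≢ e′ → ∀ j j′ → Placed (inj₂ (e , j)) (inj₂ (e′ , j′))
  inner-placed {e} {e′} e≢e′ j j′ = inj₂ (inj₂ placed)
    where
    P = pos (inj₂ (e , j))
    Q = pos (inj₂ (e′ , j′))

    P-owned : ∀ c → Owned (source e) (target e) (P c)
    P-owned = at-owned (track e) (suc (toℕ j))

    Q-owned : ∀ c → Owned (source e′) (target e′) (Q c)
    Q-owned = at-owned (track e′) (suc (toℕ j′))

    module Shared {x y z} (xy : SamePair x y (source e) (target e))
                          (xz : SamePair x z (source e′) (target e′)) where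

      y≢z : y ≢ z
      y≢z refl = e≢e′ (edge-unique e e′ xy xz)

      agree : ∀ {c} → P c ≡ Q c → P c ≡ vert x
      agree {c} eq = owned-common y≢z (owned-samePair xy (P-owned c))
        (owned-samePair xz (subst (Owned _ _) (sym eq) (Q-owned c)))

      differˡ : ∀ {c} → P c ≢ vert x → P c ≢ Q c
      differˡ p eq = p (agree eq)

      differʳ : ∀ {c} → Q c ≢ vert x → P c ≢ Q c
      differʳ q eq = q (trans (sym eq) (agree eq))

      shared : Far P Q ⊎ Clash P Q
      shared with x H.≟ v
      -- Away from `v` the two edges have distinct directions at `x`, and each path has left
      -- `vert x` in its own.
      ... | no x≢v = inj₁ (dir x y , dir x z ,
        y≢z ∘ dir-injective x≢v (edge-adjacent e xy) (edge-adjacent e′ xz) ,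
        differˡ (at-avoids (track e) xy x≢v (s≤s z≤n) (s≤s (Fin.toℕ<n j))) ,
        differʳ (at-avoids (track e′) xz x≢v (s≤s z≤n) (s≤s (Fin.toℕ<n j′))))
      -- At `v` the directions may agree, but a position beyond the launch supplies two coordinates
      -- by itself. Only two launches remain.
      ... | yes refl with at-launched (track e) xy (s≤s z≤n) (s≤s (Fin.toℕ<n j))
                        | at-launched (track e′) xz (s≤s z≤n) (s≤s (Fin.toℕ<n j′))
      ...   | inj₂ (c , dir≢c , p) | _ = inj₁ (dir v y , c , dir≢c ,
        differˡ (at-avoids-v (track e) xy (s≤s z≤n) (s≤s (Fin.toℕ<n j))) , differˡ p)
      ...   | _ | inj₂ (c , dir≢c , q) = inj₁ (dir v z , c , dir≢c ,
        differʳ (at-avoids-v (track e′) xz (s≤s z≤n) (s≤s (Fin.toℕ<n j′))) , differʳ q)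
      ...   | inj₁ p | inj₁ q = inj₂
        (y , z , edge-adjacent e xy , edge-adjacent e′ xz , y≢z , p , q)

    placed : Far P Q ⊎ Clash P Q
    placed with source e H.≟ source e′ | source e H.≟ target e′
              | target e H.≟ source e′ | target e H.≟ target e′
    ... | yes p | _ | _ | _ = Shared.shared (inj₁ (refl , refl)) (inj₁ (p , refl))
    ... | _ | yes p | _ | _ = Shared.shared (inj₁ (refl , refl)) (inj₂ (p , refl))
    ... | _ | _ | yes p | _ = Shared.shared (inj₂ (refl , refl)) (inj₁ (p , refl))
    ... | _ | _ | _ | yes p = Shared.shared (inj₂ (refl , refl)) (inj₂ (p , refl))
    ... | no ss | no st | no ts | no tt = inj₁ (everywhere⇒far (ℕ.<⇒≤ 3≤n) differ)
      where
      differ : ∀ c → P c ≢ Q c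
      differ c eq = owned-disjoint ss st ts tt (P-owned c) (subst (Owned _ _) (sym eq) (Q-owned c))

  placed : ∀ a b → Placed a b
  placed (inj₁ x) (inj₁ y) = branch-placed x y
  placed (inj₁ x) (inj₂ (e , j)) = mixed-placed x e j
  placed (inj₂ (e , j)) (inj₁ x) = placed-sym (mixed-placed x e j)
  placed (inj₂ (e , j)) (inj₂ (e′ , j′)) with Finite._≟_ (Subdivision.edge-finite (suc n) H) e e′
  ... | yes refl = subst (λ a → Placed a (inj₂ (e , j′))) (path-inner e j)
    (subst (Placed (path e (suc (inject₁ j)))) (path-inner e j′)
      (path-placed e (suc (inject₁ j)) (suc (inject₁ j′))))
  ... | no e≢e′ = inner-placed e≢e′ j j′

  -- Every case of `placed` other than equality provides a coordinate in which the tuples differ.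
  -- For a launch or a clash it is the direction of the launched edge.
  pos-injective : ∀ {a b} → pos a ≗ pos b → a ≡ b
  pos-injective {a} {b} eq with placed a b
  ... | inj₁ a≡b = a≡b
  ... | inj₂ (inj₂ (inj₁ (c , _ , _ , d , _))) = contradiction (eq c) d
  ... | inj₂ (inj₂ (inj₂ (y , z , _ , _ , y≢z , p , q))) = contradiction
    (trans (sym (p (dir v y))) (trans (eq (dir v y)) (q (dir v y))))
    (launch-differˡ y≢z (inj₁ refl))
  ... | inj₂ (inj₁ a~b) = contradiction eq (unlinked (adjacent-linked a~b))
    where
    origin≢launch : ∀ {P Q} → Launch w₀ P Q → ¬ P ≗ Q
    origin≢launch (o , l) eq
      with trans (sym (o (dir v w₀))) (trans (eq (dir v w₀)) (trans (l (dir v w₀)) (launch-yes (inj₁ refl))))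
    ... | ()

    unlinked : ∀ {P Q} → Linked P Q → ¬ P ≗ Q
    unlinked (inj₁ (c , d , _)) eq = d (eq c)
    unlinked (inj₂ (inj₁ l)) eq = origin≢launch l eq
    unlinked (inj₂ (inj₂ l)) eq = origin≢launch l (sym ∘ eq)

  -- The path replacing the edge from `v` to `w₀` has a step between these two tuples, and by
  -- injectivity of `pos` it joins `a` and `b`. Hence an added edge creates no adjacency that is
  -- absent from the subdivision.
  launch-adjacent : v ~ w₀ → ∀ {a b} → Launch w₀ (pos a) (pos b) → Adjacent a b
  launch-adjacent v~w₀ {a} {b} (o , l) with edge-between v~w₀
  ... | e , vw₀ with at-launches (track e) vw₀
  ...   | i , i<N , step = [ matched , (λ s → adjacent-sym (matched′ s)) ]′ step
    where
    j = fromℕ< i<N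

    before : pos (path e (inject₁ j)) ≗ at (track e) i
    before c = trans (pos-path e (inject₁ j) c)
      (cong (λ k → at (track e) k c) (trans (Fin.toℕ-inject₁ j) (Fin.toℕ-fromℕ< i<N)))

    after : pos (path e (suc j)) ≗ at (track e) (suc i)
    after c = trans (pos-path e (suc j) c)
      (cong (λ k → at (track e) (suc k) c) (Fin.toℕ-fromℕ< i<N))

    matched : Launch w₀ (at (track e) i) (at (track e) (suc i)) → Adjacent a b
    matched (o′ , l′) = e , j , inj₁
      ( pos-injective (λ c → trans (o c) (sym (trans (before c) (o′ c))))
      , pos-injective (λ c → trans (l c) (sym (trans (after c) (l′ c)))))

    matched′ : Launch w₀ (at (track e) (suc i)) (at (track e) i) → Adjacent b a
    matched′ (o′ , l′) = e , j , inj₁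
      ( pos-injective (λ c → trans (l c) (sym (trans (before c) (l′ c))))
      , pos-injective (λ c → trans (o c) (sym (trans (after c) (o′ c)))))

-- Neighbours and the directions assigned to them.

lookup-injective : ∀ {A : Set} {xs : List A} → Unique xs → Injective _≡_ _≡_ (List.lookup xs)
lookup-injective {xs = _ ∷ _}  _          {zero}  {zero}  _  = refl
lookup-injective {xs = _ ∷ xs} (x≢xs ∷ _) {zero}  {suc j} eq = contradiction eq (All.lookup x≢xs (∈-lookup j))
lookup-injective {xs = _ ∷ xs} (x≢xs ∷ _) {suc i} {zero}  eq = contradiction (sym eq) (All.lookup x≢xs (∈-lookup i))
lookup-injective {xs = _ ∷ _}  (_ ∷ xs!)  {suc i} {suc j} eq = cong suc (lookup-injective xs! eq)

record Neighbours (H : Graph) (v : Vertex H) (d : ℕ) : Set where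
  open Graph H using (_~_)
  field
    nth           : Fin d → Vertex H
    nth-adjacent  : ∀ i → v ~ nth i
    nth-injective : Injective _≡_ _≡_ nth
    index         : ∀ {w} → v ~ w → Fin d
    nth-index     : ∀ {w} (v~w : v ~ w) → nth (index v~w) ≡ w

  index-nth : ∀ {i} (p : v ~ nth i) → index p ≡ i
  index-nth p = nth-injective (nth-index p)

  index-injective : ∀ {y z} (p : v ~ y) (q : v ~ z) → index p ≡ index q → y ≡ z
  index-injective p q eq = trans (sym (nth-index p)) (trans (cong nth eq) (nth-index q))

neighbours : ∀ H v {d} → Graph.degree H v ≡ d → Neighbours H v d
neighbours H v refl = record
  { nth           = List.lookup ns
  ; nth-adjacent  = λ i → proj₂ (∈-filter⁻ (v H.~?_) {xs = H.elements} (∈-lookup i))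
  ; nth-injective = lookup-injective (Unique.filter⁺ (v H.~?_) H.unique)
  ; index         = λ v~w → Any.index (mem v~w)
  ; nth-index     = λ v~w → sym (Any.lookup-index (mem v~w))
  }
  where
  module H = Graph H
  ns = filter (v H.~?_) H.elements
  mem : ∀ {w} → v H.~ w → Any.Any (w ≡_) ns
  mem {w} v~w = ∈-filter⁺ (v H.~?_) (H.complete w) v~w

degree≤maxDegree : ∀ H u → Graph.degree H u ≤ Graph.maxDegree H
degree≤maxDegree H u =
  All.lookup (Extrema.xs≤max 0 (List.map H.degree H.elements)) (∈-map⁺ H.degree (H.complete u))
  where module H = Graph H

samePair-cancel : ∀ {A : Set} {x y z s t : A} → SamePair x y s t → SamePair x z s t → y ≡ z
samePair-cancel (inj₁ (refl , refl)) (inj₁ (_ , z≡t))    = sym z≡t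
samePair-cancel (inj₁ (refl , refl)) (inj₂ (x≡t , z≡x)) = trans (sym x≡t) (sym z≡x)
samePair-cancel (inj₂ (refl , refl)) (inj₁ (x≡s , z≡t)) = trans (sym x≡s) (sym z≡t)
samePair-cancel (inj₂ (refl , refl)) (inj₂ (_ , z≡s))    = sym z≡s

-- With n + 1 edges at v and only n directions, the edges to w₀ and w₁ share the direction d.
record Directions {n : ℕ} (H : Graph) (v : Vertex H) (d : Fin n) : Set where
  open Graph H using (_~_)
  field
    dir           : Vertex H → Vertex H → Fin n
    dir-injective : ∀ {x y z} → x ≢ v → x ~ y → x ~ z → dir x y ≡ dir x z → y ≡ z
    {w₀ w₁}       : Vertex H
    v~w₀          : v ~ w₀
    w₀≢w₁         : w₀ ≢ w₁
    dir-w₀        : dir v w₀ ≡ d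
    dir-w₁        : dir v w₁ ≡ d
    dir-collision : ∀ {y z} → v ~ y → v ~ z → y ≢ z → dir v y ≡ dir v z → SamePair y z w₀ w₁

directions : ∀ {n} H v → Graph.degree H v ≡ suc n → (∀ u → u ≢ v → Graph.degree H u ≤ n) →
  (d : Fin n) → Directions H v d
directions {n} H v degree-v degree-≤ d = record
  { dir           = dir
  ; dir-injective = dir-injective
  ; v~w₀          = nth-adjacent Nv zero
  ; w₀≢w₁         = Fin.0≢1+n ∘ nth-injective Nv
  ; dir-w₀        = dir-nth zero
  ; dir-w₁        = dir-nth (suc d)
  ; dir-collision = dir-collision
  }
  where
  module H = Graph H
  open H using (_~_)
  open Neighbours

  Nv : Neighbours H v (suc n)
  Nv = neighbours H v degree-v

  N : ∀ u → Neighbours H u (H.degree u)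
  N u = neighbours H u refl

  -- Neighbour 0 of `v` becomes `w₀`. It repeats the direction of neighbour `suc d`, which becomes
  -- `w₁`.
  merge : Fin (suc n) → Fin n
  merge zero    = d
  merge (suc i) = i

  merge-collision : ∀ {i j} → i ≢ j → merge i ≡ merge j → SamePair i j zero (suc d)
  merge-collision {zero}  {zero}  i≢j eq   = contradiction refl i≢j
  merge-collision {zero}  {suc j} i≢j refl = inj₁ (refl , refl)
  merge-collision {suc i} {zero}  i≢j refl = inj₂ (refl , refl)
  merge-collision {suc i} {suc j} i≢j refl = contradiction refl i≢j

  dir : Vertex H → Vertex H → Fin n
  dir u w with u H.~? w | u H.≟ v
  -- An arbitrary value: only directions along edges are constrained.
  ... | no _    | _        = d
  ... | yes u~w | no u≢v   = inject≤ (index (N u) u~w) (degree-≤ u u≢v)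
  ... | yes u~w | yes refl = merge (index Nv u~w)

  dir-injective : ∀ {x y z} → x ≢ v → x ~ y → x ~ z → dir x y ≡ dir x z → y ≡ z
  dir-injective {x} {y} {z} x≢v x~y x~z eq with x H.~? y | x H.~? z | x H.≟ v
  ... | yes p | yes q | no _    = index-injective (N x) p q (Fin.inject≤-injective _ _ _ _ eq)
  ... | _     | _     | yes x≡v = contradiction x≡v x≢v
  ... | no ¬p | _     | _       = contradiction x~y ¬p
  ... | yes _ | no ¬q | _       = contradiction x~z ¬q

  -- The adjacency proof is the one found by the decision procedure, because `index` formally
  -- depends on it.
  dir-v : ∀ {w} → v ~ w → ∃[ p ] dir v w ≡ merge (index Nv {w} p)
  dir-v {w} v~w with v H.~? w | v H.≟ v
  ... | yes p | yes refl = p , refl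
  ... | yes _ | no v≢v   = contradiction refl v≢v
  ... | no ¬p | _        = contradiction v~w ¬p

  dir-nth : ∀ i → dir v (nth Nv i) ≡ merge i
  dir-nth i with p , eq ← dir-v (nth-adjacent Nv i) = trans eq (cong merge (index-nth Nv p))

  dir-collision : ∀ {y z} → v ~ y → v ~ z → y ≢ z → dir v y ≡ dir v z → SamePair y z (nth Nv zero) (nth Nv (suc d))
  dir-collision v~y v~z y≢z eq with dir-v v~y | dir-v v~z
  ... | p , eqy | q , eqz
    with merge-collision (y≢z ∘ index-injective Nv p q) (trans (sym eqy) (trans eq eqz))
  ... | inj₁ (i , j) = inj₁ (trans (sym (nth-index Nv p)) (cong (nth Nv) i) ,
                             trans (sym (nth-index Nv q)) (cong (nth Nv) j))
  ... | inj₂ (i , j) = inj₂ (trans (sym (nth-index Nv p)) (cong (nth Nv) i) ,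
                             trans (sym (nth-index Nv q)) (cong (nth Nv) j))

-- Relabellings with prescribed values, and adjacency in products of cliques.

module _ {A : Set} (FA : Finite A) where
  open Finite FA using (size; rank; rank-injective)

  labelling-through₁ : ∀ {α} p → ∃[ L ] (Injective _≡_ _≡_ L × L α ≡ p)
  labelling-through₁ {α} p = (λ x → transpose (rank α) p ⟨$⟩ʳ rank x) ,
    (λ eq → rank-injective (⟨$⟩ʳ-injective (transpose (rank α) p) eq)) ,
    transpose-left (rank α) p

  labelling-through₂ : ∀ {α β} {p q : Fin size} → α ≢ β → p ≢ q →
    ∃[ L ] (Injective _≡_ _≡_ L × L α ≡ p × L β ≡ q)
  labelling-through₂ α≢β p≢q with permutation-through₂ (α≢β ∘ rank-injective) p≢q
  ... | π , πα , πβ = (λ x → π ⟨$⟩ʳ rank x) ,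
    (λ eq → rank-injective (⟨$⟩ʳ-injective π eq)) , πα , πβ

vec-ext : ∀ {A : Set} {n} {xs ys : Vec A n} → lookup xs ≗ lookup ys → xs ≡ ys
vec-ext {xs = xs} {ys} eq =
  trans (sym (Vec.tabulate∘lookup xs)) (trans (Vec.tabulate-cong eq) (Vec.tabulate∘lookup ys))

inhabited : ∀ {l} → Fin l → 1 ≤ l
inhabited zero    = s≤s z≤n
inhabited (suc _) = s≤s z≤n

two-elements : ∀ {l} {i j : Fin l} → i ≢ j → 2 ≤ l
two-elements {suc zero} {zero} {zero} i≢j = contradiction refl i≢j
two-elements {suc (suc _)} _ = s≤s (s≤s z≤n)

replicate-injective : ∀ {A : Set} {n} {x y : A} → 1 ≤ n → Vec.replicate n x ≡ Vec.replicate n y → x ≡ y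
replicate-injective (s≤s _) = Vec.∷-injectiveˡ

module _ {n k : ℕ} where
  open Graph (□^ n K k) using (_~_)

  -- The tuples that agree with `x` outside one coordinate form a clique.
  ~-or-≡ : ∀ {x y z : Vec (Fin k) n} (x~y : x ~ y) (x~z : x ~ z) →
    proj₁ x~y ≡ proj₁ x~z → y ≡ z ⊎ y ~ z
  ~-or-≡ {x} {y} {z} (i , _ , uy) (.i , _ , uz) refl with lookup y i Fin.≟ lookup z i
  ... | yes eq = inj₁ (vec-ext agree)
    where
    agree : lookup y ≗ lookup z
    agree c with i Fin.≟ c
    ... | yes refl = eq
    ... | no i≢c   = trans (sym (decidable-stable (_ Fin.≟ _) (i≢c ∘ uy)))
                           (decidable-stable (_ Fin.≟ _) (i≢c ∘ uz))
  ... | no neq = inj₂ (i , neq , unique)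
    where
    unique : ∀ {c} → lookup y c ≢ lookup z c → i ≡ c
    unique {c} d with i Fin.≟ c
    ... | yes i≡c = i≡c
    ... | no i≢c  = contradiction
      (trans (sym (decidable-stable (_ Fin.≟ _) (i≢c ∘ uy)))
             (decidable-stable (_ Fin.≟ _) (i≢c ∘ uz))) d

  far⇒≁ : ∀ {x y : Vec (Fin k) n} → Far (lookup x) (lookup y) → ¬ x ~ y
  far⇒≁ (c , c′ , c≢c′ , d , d′) (i , _ , u) = c≢c′ (trans (sym (u d)) (u d′))

  -- If `c` were the only difference, `x` and `y` would be adjacent. Searching the finitely many
  -- coordinates turns this into a witness.
  another-difference : ∀ {x y : Vec (Fin k) n} → ¬ x ~ y → ∀ {c} → Differ (lookup x) (lookup y) c →
    ∃[ c′ ] (c ≢ c′ × Differ (lookup x) (lookup y) c′)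
  another-difference {x} {y} x≁y {c} d =
    decidable-stable (Fin.any? λ c′ → ¬? (c Fin.≟ c′) ×-dec ¬? (lookup x c′ Fin.≟ lookup y c′))
      λ none → x≁y (c , d , λ {c′} d′ → decidable-stable (c Fin.≟ c′) λ c≢c′ → none (c′ , c≢c′ , d′))

  some-difference : ∀ {x y : Vec (Fin k) n} → x ≢ y → ∃[ c ] Differ (lookup x) (lookup y) c
  some-difference {x} {y} x≢y =
    decidable-stable (Fin.any? λ c → ¬? (lookup x c Fin.≟ lookup y c))
      λ none → x≢y (vec-ext λ c → decidable-stable (_ Fin.≟ _) λ neq → none (c , neq))

-- The product contains no induced copy of the subdivision.

module Starless {n : ℕ} (k l : ℕ) (H : Graph) (v : Vertex H) (degree-v : Graph.degree H v ≡ suc n) where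
  private module H = Graph H
  open Subdivision (suc l) H
  open SubdivisionPaths (suc l) H
  open Neighbours (neighbours H v degree-v)

  path-edge : ∀ e {e′ j} i → path e i ≡ inj₂ (e′ , j) → e ≡ e′
  path-edge e (suc i) eq with view i
  path-edge e (suc _) refl | ‵inject₁ _ = refl

  -- Each step belongs to one path, and an inner vertex determines its path.
  inner-adjacent : ∀ {e e′ j j′} → Adjacent (inj₂ (e , j)) (inj₂ (e′ , j′)) → e ≡ e′
  inner-adjacent (e , i , inj₁ (p , q)) =
    trans (sym (path-edge e (inject₁ i) (sym p))) (path-edge e (suc i) (sym q))
  inner-adjacent (e , i , inj₂ (p , q)) =
    trans (sym (path-edge e (suc i) (sym p))) (path-edge e (inject₁ i) (sym q))

  -- At least one vertex is inserted into each edge, so the neighbour of `v` on the path is an inner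
  -- vertex: the first if `v` is the source, the last if it is the target.
  leaf : ∀ {w} → v H.~ w → ∃[ e ] ∃[ j ]
    (SamePair v w (source e) (target e) × Adjacent (inj₁ v) (inj₂ (e , j)))
  leaf v~w with edge-between v~w
  ... | e , vw = e , proj₁ (first vw) , vw , proj₂ (first vw)
    where
    first : ∀ {w} → SamePair v w (source e) (target e) → ∃[ j ] Adjacent (inj₁ v) (inj₂ (e , j))
    first (inj₁ (refl , _)) = zero , e , zero , inj₁ (refl , refl)
    first (inj₂ (refl , _)) = fromℕ l , e , fromℕ (suc l) ,
      inj₂ (sym (path-last e) , sym (path-inner e (fromℕ l)))

  -- Any n + 1 neighbours of a vertex of the product use some direction twice.
  not-in-product : ¬ subdivide (suc l) H ⊆ᴵ (□^ n K k)
  not-in-product H′⊆G = collide (⊆ᴵ⇒embedding (subdivide (suc l) H) (□^ n K k) H′⊆G)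
    where
    edge : Fin (suc n) → Edge
    edge i = proj₁ (leaf (nth-adjacent i))

    tip : Fin (suc n) → V′
    tip i = inj₂ (edge i , proj₁ (proj₂ (leaf (nth-adjacent i))))

    edge-ends : ∀ i → SamePair v (nth i) (source (edge i)) (target (edge i))
    edge-ends i = proj₁ (proj₂ (proj₂ (leaf (nth-adjacent i))))

    v~tip : ∀ i → Adjacent (inj₁ v) (tip i)
    v~tip i = proj₂ (proj₂ (proj₂ (leaf (nth-adjacent i))))

    inj₂-edge : ∀ {i j} → tip i ≡ tip j → edge i ≡ edge j
    inj₂-edge = cong proj₁ ∘ inj₂-injective

    edge-injective : ∀ {i j} → edge i ≡ edge j → i ≡ j
    edge-injective {i} {j} eq = nth-injective (samePair-cancel (edge-ends i)
      (subst (λ e → SamePair v (nth j) (source e) (target e)) (sym eq) (edge-ends j)))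

    collide : ¬ (∃[ f ] (Injective _≡_ _≡_ f ×
      (∀ a b → Adjacent a b ⇔ Graph._~_ (□^ n K k) (f a) (f b))))
    collide (f , f-inj , f-adj) = two-alike
      where
      fv~ftip : ∀ i → Graph._~_ (□^ n K k) (f (inj₁ v)) (f (tip i))
      fv~ftip i = Equivalence.to (f-adj (inj₁ v) (tip i)) (v~tip i)

      two-alike : ⊥
      two-alike with Fin.pigeonhole (ℕ.n<1+n n) (λ i → proj₁ (fv~ftip i))
      -- Two tips in the same direction are equal or adjacent, and either way they lie on the same
      -- path.
      ... | i , j , i<j , eq = Fin.<⇒≢ i<j (edge-injective
        (Sum.[ inj₂-edge {i} {j} ∘ f-inj , inner-adjacent ∘ Equivalence.from (f-adj (tip i) (tip j)) ]
          (~-or-≡ {x = f (inj₁ v)} (fv~ftip i) (fv~ftip j) eq)))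

-- Copies of the subdivision after an edge of the product is added or deleted.

module Saturation (n : ℕ) (3≤n : 3 ≤ n) (H : Graph) (v : Vertex H)
  (label-finite : Finite (Label (Vertex H)))
  (δ : (d : Fin n) → Directions H v d) where

  private
    module H = Graph H

  open Subdivision (suc n) H using (V′; Adjacent)

  k : ℕ
  k = Finite.size label-finite

  private
    H′ = subdivide (suc n) H
    G = □^ n K k
    module G = Graph G

  module Host (x y : Vec (Fin k) n) (d : Fin n) (d-differ : Differ (lookup x) (lookup y) d) where
    open Directions (δ d) public

    differ? : Decidable (Differ (lookup x) (lookup y))
    differ? c = ¬? (lookup x c Fin.≟ lookup y c)

    open Drawing n 3≤n H v w₀ dir dir-injective differ? public

    -- A separate injection in each coordinate preserves equality and inequality there, hence
    -- `DifferOnce` and `Far`. Choosing the injections separately lets chosen tuples of labels land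
    -- on the given `x` and `y`.
    module Labelled (L : Fin n → Label H.Vertex → Fin k) (L-injective : ∀ c → Injective _≡_ _≡_ (L c)) where

      embed : Position → Vec (Fin k) n
      embed P = tabulate (λ c → L c (P c))

      lookup-embed : ∀ P c → lookup (embed P) c ≡ L c (P c)
      lookup-embed P = Vec.lookup∘tabulate (λ c → L c (P c))

      embed-cong : ∀ {P Q} → P ≗ Q → embed P ≡ embed Q
      embed-cong eq = Vec.tabulate-cong (λ c → cong (L c) (eq c))

      lookup-injective′ : ∀ {P Q c} → lookup (embed P) c ≡ lookup (embed Q) c → P c ≡ Q c
      lookup-injective′ {P} {Q} {c} eq = L-injective c
        (trans (sym (lookup-embed P c)) (trans eq (lookup-embed Q c)))

      embed-injective : ∀ P Q → embed P ≡ embed Q → P ≗ Q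
      embed-injective P Q eq c = lookup-injective′ {P} {Q} (cong (λ z → lookup z c) eq)

      lookup-cong : ∀ {P Q c} → P c ≡ Q c → lookup (embed P) c ≡ lookup (embed Q) c
      lookup-cong {P} {Q} {c} eq =
        trans (lookup-embed P c) (trans (cong (L c) eq) (sym (lookup-embed Q c)))

      embed-once : ∀ {P Q} → DifferOnce P Q → embed P G.~ embed Q
      embed-once {P} {Q} (c , d , u) =
        c , d ∘ lookup-injective′ {P} {Q} , λ d′ → u (d′ ∘ lookup-cong {P} {Q})

      embed-far : ∀ {P Q} → Far P Q → ¬ embed P G.~ embed Q
      embed-far {P} {Q} (c , c′ , c≢c′ , d , d′) = far⇒≁ {x = embed P} {embed Q}
        (c , c′ , c≢c′ , d ∘ lookup-injective′ {P} {Q} , d′ ∘ lookup-injective′ {P} {Q})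

      place : V′ → Vec (Fin k) n
      place a = embed (pos a)

      place-injective : Injective _≡_ _≡_ place
      place-injective {a} {b} eq = pos-injective {a} {b} (embed-injective (pos a) (pos b) eq)

  -- Designed to send `origin` to `x` and `launch w₀` to `y`, so that the added edge is the first
  -- step from `v` towards `w₀`.
  AddLabels : (x y : Vec (Fin k) n) (w : H.Vertex) → Fin n → Set
  AddLabels x y w c = ∃[ L ] (Injective _≡_ _≡_ L × L (vert v) ≡ lookup x c ×
    (lookup x c ≢ lookup y c → L (arc v w) ≡ lookup y c))

  addLabels : ∀ x y w c → AddLabels x y w c
  addLabels x y w c with lookup x c Fin.≟ lookup y c
  ... | no d with labelling-through₂ label-finite {vert v} {arc v w} (λ ()) d
  ...   | L , L-inj , Lv , La = L , L-inj , Lv , λ _ → La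
  addLabels x y w c | yes e with labelling-through₁ label-finite {vert v} (lookup x c)
  ... | L , L-inj , Lv = L , L-inj , Lv , λ d → contradiction e d

  module Added {x y : Vec (Fin k) n} (x≁y : Graph._~_ (complement G) x y)
    (d : Fin n) (d-differ : Differ (lookup x) (lookup y) d)
    (labelling : ∀ c → AddLabels x y (Directions.w₀ (δ d)) c) where

    open Host x y d d-differ

    L : Fin n → Label H.Vertex → Fin k
    L c = proj₁ (labelling c)

    open Labelled L (λ c → proj₁ (proj₂ (labelling c)))

    L-v : ∀ c → L c (vert v) ≡ lookup x c
    L-v c = proj₁ (proj₂ (proj₂ (labelling c)))

    embed-origin : embed origin ≡ x
    embed-origin = vec-ext (λ c → trans (lookup-embed origin c) (L-v c))

    embed-launch : embed (launch w₀) ≡ y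
    embed-launch = vec-ext (λ c → trans (lookup-embed (launch w₀) c) (at-coordinate (differ? c)))
      where
      at-coordinate : ∀ {c} → Dec (Differ (lookup x) (lookup y) c) → L c (launch w₀ c) ≡ lookup y c
      at-coordinate {c} (yes D) = trans (cong (L c) (launch-yes (inj₂ ((refl , refl) , D))))
        (proj₂ (proj₂ (proj₂ (labelling c))) D)
      -- Where `x` and `y` agree there is no exit, because the direction of `w₀` is `d` and they
      -- differ in `d`.
      at-coordinate {c} (no ¬D) = trans (cong (L c) (launch-no λ
          { (inj₁ refl) → ¬D (subst (Differ (lookup x) (lookup y)) (sym dir-w₀) d-differ)
          ; (inj₂ (_ , D)) → ¬D D }))
        (trans (L-v c) (decidable-stable (_ Fin.≟ _) ¬D))

    linked : ∀ {P Q} → Linked P Q → Graph._~_ (addEdge G x y x≁y) (embed P) (embed Q)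
    linked {P} {Q} (inj₁ once)           = inj₁ (embed-once {P} {Q} once)
    linked (inj₂ (inj₁ (o , l))) =
      inj₂ (inj₁ (trans (embed-cong o) embed-origin , trans (embed-cong l) embed-launch))
    linked (inj₂ (inj₂ (o , l))) =
      inj₂ (inj₂ (trans (embed-cong l) embed-launch , trans (embed-cong o) embed-origin))

    -- Being nonadjacent, `x` and `y` differ in a coordinate besides `d`, and `launch w₀` holds
    -- `arc v w₀` in both.
    launch-far : ∀ {z} → z ≢ w₀ → Far (launch w₀) (launch z)
    launch-far {z} z≢w₀ with another-difference {x = x} {y} (proj₂ x≁y) d-differ
    ... | d′ , d≢d′ , d′-differ = d , d′ , d≢d′ ,
      launch-differˡ (z≢w₀ ∘ sym) (inj₂ ((refl , refl) , d-differ)) ,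
      launch-differˡ (z≢w₀ ∘ sym) (inj₂ ((refl , refl) , d′-differ))

    -- Distinct directions are themselves the two witnesses. Launches in a common direction include
    -- that of `w₀`, to which `launch-far` applies.
    clash-far : ∀ {P Q} → Clash P Q → Far P Q
    clash-far (y , z , v~y , v~z , y≢z , p , q) = far-resp (sym ∘ p) (sym ∘ q) (launches y z v~y v~z y≢z)
      where
      launches : ∀ y z → v H.~ y → v H.~ z → y ≢ z → Far (launch y) (launch z)
      launches y z v~y v~z y≢z with dir v y Fin.≟ dir v z
      ... | no neq = dir v y , dir v z , neq , launch-differˡ y≢z (inj₁ refl) ,
        launch-differˡ (y≢z ∘ sym) (inj₁ refl) ∘ sym
      ... | yes eq with dir-collision v~y v~z y≢z eq
      ...   | inj₁ (refl , _) = launch-far (y≢z ∘ sym)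
      ...   | inj₂ (_ , refl) = far-sym (launch-far y≢z)

    launched : ∀ {a b} → place a ≡ x → place b ≡ y → Adjacent a b
    launched {a} {b} p q = launch-adjacent v~w₀ {a} {b}
      ( embed-injective (pos a) origin (trans p (sym embed-origin))
      , embed-injective (pos b) (launch w₀) (trans q (sym embed-launch)))

    adjacent : ∀ a b → Graph._~_ (addEdge G x y x≁y) (place a) (place b) → Adjacent a b
    adjacent a b (inj₂ (inj₁ (p , q))) = launched {a} {b} p q
    adjacent a b (inj₂ (inj₂ (p , q))) = adjacent-sym {b} {a} (launched {b} {a} q p)
    adjacent a b (inj₁ adj) with placed a b
    ... | inj₁ refl                = contradiction adj (G.~-irrefl {place a} refl)
    ... | inj₂ (inj₁ a~b)          = a~b
    ... | inj₂ (inj₂ (inj₁ far))   = contradiction adj (embed-far {pos a} {pos b} far)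
    ... | inj₂ (inj₂ (inj₂ clash)) = contradiction adj (embed-far {pos a} {pos b} (clash-far clash))

    embedded : H′ ⊆ᴵ addEdge G x y x≁y
    embedded = embedding⇒⊆ᴵ H′ (addEdge G x y x≁y) place place-injective
      (λ a b → mk⇔ (λ a~b → linked (adjacent-linked {a} {b} a~b)) (adjacent a b))

  -- Designed to send `launch w₀` to `x` and `launch w₁` to `y`. The deleted edge is then exactly
  -- the unwanted adjacency between these two launches.
  DeleteLabels : (x y : Vec (Fin k) n) (w w′ : H.Vertex) → Fin n → Set
  DeleteLabels x y w w′ c = ∃[ L ] (Injective _≡_ _≡_ L ×
    (lookup x c ≢ lookup y c → L (arc v w) ≡ lookup x c × L (arc v w′) ≡ lookup y c) ×
    (¬ lookup x c ≢ lookup y c → L (vert v) ≡ lookup x c))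

  deleteLabels : ∀ x y {w w′} → w ≢ w′ → ∀ c → DeleteLabels x y w w′ c
  deleteLabels x y {w} {w′} w≢w′ c with lookup x c Fin.≟ lookup y c
  ... | no d with labelling-through₂ label-finite {arc v w} {arc v w′} (λ { refl → w≢w′ refl }) d
  ...   | L , L-inj , L₀ , L₁ = L , L-inj , (λ _ → L₀ , L₁) , λ ¬d → contradiction d ¬d
  deleteLabels x y w≢w′ c | yes e with labelling-through₁ label-finite {vert v} (lookup x c)
  ... | L , L-inj , Lv = L , L-inj , (λ d → contradiction e d) , λ _ → Lv

  module Deleted {x y : Vec (Fin k) n} (x~y : x G.~ y)
    (labelling : ∀ c → DeleteLabels x y
      (Directions.w₀ (δ (proj₁ x~y))) (Directions.w₁ (δ (proj₁ x~y))) c) where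

    private
      d = proj₁ x~y
      d-differ = proj₁ (proj₂ x~y)

      d-unique : ∀ {c} → Differ (lookup x) (lookup y) c → d ≡ c
      d-unique = proj₂ (proj₂ x~y)

    open Host x y d d-differ

    L : Fin n → Label H.Vertex → Fin k
    L c = proj₁ (labelling c)

    open Labelled L (λ c → proj₁ (proj₂ (labelling c)))

    -- As `x` and `y` are adjacent, `d` is the only coordinate in which they differ, so the modified
    -- edge adds no further exit.
    exit-d : ∀ {w c} → dir v w ≡ d → Exit v w c → d ≡ c
    exit-d dir≡d (inj₁ refl)    = sym dir≡d
    exit-d dir≡d (inj₂ (_ , D)) = d-unique D

    embed-launch : ∀ {w z} → dir v w ≡ d →
      (∀ c → ¬ Differ (lookup x) (lookup y) c → lookup x c ≡ lookup z c) →
      L d (arc v w) ≡ lookup z d → embed (launch w) ≡ z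
    embed-launch {w} {z} dir≡d same La = vec-ext
      (λ c → trans (lookup-embed (launch w) c) (at-coordinate (d Fin.≟ c)))
      where
      at-coordinate : ∀ {c} → Dec (d ≡ c) → L c (launch w c) ≡ lookup z c
      at-coordinate (yes refl) = trans (cong (L d) (launch-yes (inj₁ (sym dir≡d)))) La
      at-coordinate {c} (no d≢c) = trans (cong (L c) (launch-no (d≢c ∘ exit-d dir≡d)))
        (trans (proj₂ (proj₂ (proj₂ (labelling c))) (d≢c ∘ d-unique)) (same c (d≢c ∘ d-unique)))

    L-d : L d (arc v w₀) ≡ lookup x d × L d (arc v w₁) ≡ lookup y d
    L-d = proj₁ (proj₂ (proj₂ (labelling d))) d-differ

    embed-launch₀ : embed (launch w₀) ≡ x
    embed-launch₀ = embed-launch dir-w₀ (λ _ _ → refl) (proj₁ L-d)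

    embed-launch₁ : embed (launch w₁) ≡ y
    embed-launch₁ = embed-launch dir-w₁ (λ _ → decidable-stable (_ Fin.≟ _)) (proj₂ L-d)

    -- Here the step from `origin` to `launch w₀` is an ordinary edge of the product.
    launch-once : DifferOnce origin (launch w₀)
    launch-once = d , differ , unique
      where
      differ : Differ origin (launch w₀) d
      differ eq with trans eq (launch-yes (inj₁ (sym dir-w₀)))
      ... | ()

      unique : ∀ {c} → Differ origin (launch w₀) c → d ≡ c
      unique {c} D with exit? v w₀ c
      ... | yes e = exit-d dir-w₀ e
      ... | no ¬e = contradiction (sym (launch-no ¬e)) D

    linked : ∀ {P Q} → Linked P Q → embed P G.~ embed Q
    linked {P} {Q} (inj₁ once)           = embed-once {P} {Q} once
    linked {P} {Q} (inj₂ (inj₁ (o , l))) =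
      embed-once {P} {Q} (differOnce-resp (sym ∘ o) (sym ∘ l) launch-once)
    linked {P} {Q} (inj₂ (inj₂ (o , l))) =
      embed-once {P} {Q} (differOnce-sym (differOnce-resp (sym ∘ o) (sym ∘ l) launch-once))

    -- In coordinate d, x and y carry labels owned by different edges at v.
    separated : ∀ {a b} → Adjacent a b → place a ≡ x → place b ≢ y
    separated {a} {b} a~b p q with adjacent-owned {a} {b} a~b
    ... | s , t , a-owned , b-owned = w₀≢w₁ (samePair-cancel
      (owned-arc (subst (Owned s t)
        (trans (pos-d {a} {w₀} p embed-launch₀) (launch-yes (inj₁ (sym dir-w₀)))) (a-owned d)))
      (owned-arc (subst (Owned s t)
        (trans (pos-d {b} {w₁} q embed-launch₁) (launch-yes (inj₁ (sym dir-w₁)))) (b-owned d))))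
      where
      pos-d : ∀ {a w z} → place a ≡ z → embed (launch w) ≡ z → pos a d ≡ launch w d
      pos-d {a} {w} p q = embed-injective (pos a) (launch w) (trans p (sym q)) d

    unspoiled : ∀ {a b} → Adjacent a b → ¬ SamePair (place a) (place b) x y
    unspoiled {a} {b} a~b (inj₁ (p , q)) = separated {a} {b} a~b p q
    unspoiled {a} {b} a~b (inj₂ (p , q)) = separated {b} {a} (adjacent-sym {a} {b} a~b) q p

    -- Only `w₀` and `w₁` share a direction at `v`, and their launches are embedded as the ends of
    -- the deleted edge.
    clash : ∀ {P Q} → Clash P Q → Far P Q ⊎ SamePair (embed P) (embed Q) x y
    clash (y , z , v~y , v~z , y≢z , p , q) with dir v y Fin.≟ dir v z
    ... | no neq = inj₁ (far-resp (sym ∘ p) (sym ∘ q)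
      (dir v y , dir v z , neq , launch-differˡ y≢z (inj₁ refl) ,
        launch-differˡ (y≢z ∘ sym) (inj₁ refl) ∘ sym))
    ... | yes eq with dir-collision v~y v~z y≢z eq
    ...   | inj₁ (refl , refl) =
      inj₂ (inj₁ (trans (embed-cong p) embed-launch₀ , trans (embed-cong q) embed-launch₁))
    ...   | inj₂ (refl , refl) =
      inj₂ (inj₂ (trans (embed-cong p) embed-launch₁ , trans (embed-cong q) embed-launch₀))

    adjacent : ∀ a b → Graph._~_ (deleteEdge G x y x~y) (place a) (place b) → Adjacent a b
    adjacent a b (adj , ¬xy) with placed a b
    ... | inj₁ refl              = contradiction adj (G.~-irrefl {place a} refl)
    ... | inj₂ (inj₁ a~b)        = a~b
    ... | inj₂ (inj₂ (inj₁ far)) = contradiction adj (embed-far {pos a} {pos b} far)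
    ... | inj₂ (inj₂ (inj₂ cl)) with clash {pos a} {pos b} cl
    ...   | inj₁ far = contradiction adj (embed-far {pos a} {pos b} far)
    ...   | inj₂ xy  = contradiction xy ¬xy

    embedded : H′ ⊆ᴵ deleteEdge G x y x~y
    embedded = embedding⇒⊆ᴵ H′ (deleteEdge G x y x~y) place place-injective
      (λ a b → mk⇔ (λ a~b → linked (adjacent-linked {a} {b} a~b) , unspoiled {a} {b} a~b) (adjacent a b))

  constant : Label H.Vertex → G.Vertex
  constant ℓ = Vec.replicate n (Finite.rank label-finite ℓ)

  saturated⁻ : ∀ {x y} (x~y : x G.~ y) → H′ ⊆ᴵ deleteEdge G x y x~y
  saturated⁻ {x} {y} x~y = Deleted.embedded x~y
    (deleteLabels x y (Directions.w₀≢w₁ (δ (proj₁ x~y))))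

  saturated⁺ : ∀ {x y} (x≁y : Graph._~_ (complement G) x y) → H′ ⊆ᴵ addEdge G x y x≁y
  saturated⁺ {x} {y} x≁y = differing (some-difference (proj₁ x≁y))
    where
    differing : ∃[ d ] Differ (lookup x) (lookup y) d → H′ ⊆ᴵ addEdge G x y x≁y
    differing (d , d-differ) =
      Added.embedded {x} {y} x≁y d d-differ (addLabels x y (Directions.w₀ (δ d)))

  nontrivial : 2 ≤ G.order
  nontrivial = two-elements {i = G.rank (constant (vert v))} {G.rank (constant (arc v v))}
    (distinct ∘ G.rank-injective)
    where
    distinct : constant (vert v) ≢ constant (arc v v)
    distinct eq with Finite.rank-injective label-finite (replicate-injective (ℕ.<⇒≤ (ℕ.<⇒≤ 3≤n)) eq)
    ... | ()

  saturated : Graph.degree H v ≡ suc n → InducedSaturated H′ G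
  saturated degree-v = record
    { nontrivial = nontrivial
    ; free       = Starless.not-in-product k n H v degree-v
    ; saturated⁻ = saturated⁻
    ; saturated⁺ = saturated⁺
    }

-- From the degree conditions to saturation.

subdivision-saturated : ∀ n → 3 ≤ n → ∀ H v → Graph.degree H v ≡ suc n →
  (∀ u → u ≢ v → Graph.degree H u ≤ n) →
  ∃[ k ] (1 ≤ k × InducedSaturated (subdivide (suc n) H) (□^ n K k))
subdivision-saturated n 3≤n H v degree-v degree-≤ =
  -- Here k is the number of labels, m + m² for a graph of order m.
  Finite.size label-finite , inhabited (Finite.rank label-finite (vert v)) ,
  Saturation.saturated n 3≤n H v label-finite (directions H v degree-v degree-≤) degree-v
  where
  label-finite : Finite (Label (Vertex H))
  label-finite = ⊎-finite (Graph.finite H) (×-finite (Graph.finite H) (Graph.finite H))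

max-degree-elsewhere : ∀ H v {n} → Graph.maxDegree H ≡ suc n →
  (∀ u → Graph.degree H u ≡ Graph.maxDegree H → u ≡ v) → ∀ u → u ≢ v → Graph.degree H u ≤ n
max-degree-elsewhere H v maxDegree≡ v-unique u u≢v = s≤s⁻¹ (subst (Graph.degree H u <_) maxDegree≡
    (ℕ.≤∧≢⇒< (degree≤maxDegree H u) (u≢v ∘ v-unique u)))

corollary3 : (n : ℕ) → 4 ≤ n →
    (H : Graph) (v : Graph.Vertex H) →
    Graph.degree H v ≡ Graph.maxDegree H →
    (∀ u → Graph.degree H u ≡ Graph.maxDegree H → u ≡ v) →
    Graph.maxDegree H ≡ n + 1 →
    Graph.maxDegree (H -ᵛ v) ≤ n ∸ 1 →
    ∃[ k ] (1 ≤ k × InducedSaturated (subdivide (n + 1) H) (□^ n K k))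
corollary3 n 4≤n H v degree-v v-unique maxDegree-H _ =
  subst (λ l → ∃[ k ] (1 ≤ k × InducedSaturated (subdivide l H) (□^ n K k))) (ℕ.+-comm 1 n)
    (subdivision-saturated n (ℕ.<⇒≤ 4≤n) H v (trans degree-v maxDegree≡)
      (max-degree-elsewhere H v maxDegree≡ v-unique))
  where
  maxDegree≡ : Graph.maxDegree H ≡ suc n
  maxDegree≡ = trans maxDegree-H (ℕ.+-comm n 1)
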